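{- Let $p$ be a prime and let $d \in \{0, 1, \dots, p - 1\}$. Then the denominator of the rational number $A'(d)$ is not divisible by $p$. Moreover, for all $n \in \mathbb{Z}$, \[ A(d + p n) \equiv \left(A(d) + p n A'(d)\right) A(n) \pmod{p^2}. \]
   Context: $A(z)$ denotes the Ap\'ery function, the entire function \[ A(z) = \sum_{k \geq 0} \frac{\Gamma(z + k + 1)^2}{\Gamma(z - k + 1)^2\, \Gamma(k + 1)^4} = \sum_{k\ge 0}\frac{(-z)_k^2\,(z+1)_k^2}{k!^4}, \] where $(x)_k = x(x+1)\cdots(x+k-1)$; each summand is a polynomial in $z$. For non-negative integers $n$, $A(n)=\sum_{k\ge0}\binom{n}{k}^2\binom{n+k}{k}^2$; for negative integers $n$, $A(n)$ is the value of this entire function (an integer, since $A(n)=A(-1-n)$). For integers $n \geq 0$, \[ A'(n) = 2 \sum_{k = 0}^n \binom{n}{k}^2 \binom{n + k}{k}^2 \left(H_{n + k} - H_{n - k}\right), \] where $H_k = 1 + \frac12 + \dots + \frac1k$ is the $k$th harmonic number; this equals the derivative $\frac{d}{dz}A(z)$ at $z=n$. A congruence modulo $p^2$ involving rationals whose denominators are coprime to $p$ is understood in $\mathbb{Z}_{(p)}$. -}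

module Defs where

open import Data.Nat as ℕ using (ℕ; zero; suc; _!)
open import Data.Nat.Properties using (_!≢0)
open import Data.Nat.Combinatorics using (_C_)
open import Data.Nat.Divisibility using (_∣_)
open import Data.Integer as ℤ using (ℤ; +_)
open import Data.Rational as ℚ using (ℚ; ↧ₙ_; _/_)
open import Data.Product using (Σ; _×_)
open import Relation.Nullary using (¬_)
open import Relation.Binary.PropositionalEquality using (_≡_)

ℤ→ℚ : ℤ → ℚ
ℤ→ℚ z = z / 1

ℕ→ℚ : ℕ → ℚ
ℕ→ℚ n = ℤ→ℚ (+ n)

sumTo : ℕ → (ℕ → ℚ) → ℚ
sumTo zero    f = f 0
sumTo (suc n) f = sumTo n f ℚ.+ f (suc n)

poch : ℚ → ℕ → ℚ
poch x zero    = ℚ.1ℚ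
poch x (suc k) = poch x k ℚ.* (x ℚ.+ ℕ→ℚ k)

-- Apéry function at an integer z:
--   A(z) = Σ_{k≥0} (-z)_k^2 (z+1)_k^2 / k!^4 .
-- For integer z all summands with k > ∣z∣ vanish (one of the Pochhammer
-- factors contains a zero factor), so the sum is truncated at k = ∣z∣.
A : ℤ → ℚ
A z = sumTo ℤ.∣ z ∣ λ k →
  let a = poch (ℚ.- ℤ→ℚ z) k
      b = poch (ℤ→ℚ z ℚ.+ ℚ.1ℚ) k
      f = ((+ 1) / (k !)) {{k !≢0}}
  in a ℚ.* a ℚ.* b ℚ.* b ℚ.* f ℚ.* f ℚ.* f ℚ.* f

H : ℕ → ℚ
H zero    = ℚ.0ℚ
H (suc m) = H m ℚ.+ (+ 1) / suc m

A′ : ℕ → ℚ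
A′ n = ℕ→ℚ 2 ℚ.* sumTo n λ k →
  ℕ→ℚ (((n C k) ℕ.^ 2) ℕ.* (((n ℕ.+ k) C k) ℕ.^ 2))
    ℚ.* (H (n ℕ.+ k) ℚ.- H (n ℕ.∸ k))

-- x ≡ y (mod m) in ℤ_(p): x - y = m · r for some rational r whose
-- (reduced) denominator is not divisible by p.
CongModIn : (p : ℕ) (m : ℕ) → ℚ → ℚ → Set
CongModIn p m x y = Σ ℚ λ r → ¬ (p ∣ ↧ₙ r) × (x ℚ.- y ≡ ℕ→ℚ m ℚ.* r)

{-# OPTIONS --safe #-}
module Submission where

-- Put c(z,k) = (-z)_k (z+1)_k / k!², so that A(z) = Σ_k c(z,k)². For digits d, j < p one finds
-- c(d+pn, pm+j) = c(n,m) c(d,j) v, where v² ≡ 1 + 2p(n(H_{d+j} - H_{d-j}) + m(H_{d+j} + H_{d-j} - 2H_j)) mod p²,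
-- provided that j ≤ d and d + j < p; otherwise p divides both c(d+pn, pm+j) and c(d,j). Summing the squares
-- over j, the part with n gives pnA'(d), and the part with m drops out because
-- Σ_j c(d,j)² (H_{d+j} + H_{d-j} - 2H_j) = 0. Up to sign and a factor 2 this is the sum of the residues of the
-- square of Σ_i c(d,i)/(t+i) = Π_{1≤r≤d} (r-t) / Π_{0≤r≤d} (r+t): the residue at t = -j is
-- 2 c(d,j) Σ_{i≠j} c(d,i)/(i-j), and these are antisymmetric in i and j.

open import Defs
open import Data.Nat using (ℕ; _<_; _^_)
open import Data.Nat.Base as ℕ using (zero; suc; _!; _≤_; z≤n; s≤s)
open import Data.Nat.Properties as ℕ using (_!≢0)
open import Data.Nat.Combinatorics using (_C_; nCk+nC[k+1]≡[n+1]C[k+1]; nCn≡1; k>n⇒nCk≡0)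
open import Data.Nat.Coprimality using (coprime-divisor) renaming (recompute to coprime-recompute; sym to coprime-sym)
open import Data.Nat.Divisibility using (_∣_; divides; ∣1⇒≡1; _∣0; ∣-trans; ∣m+n∣m⇒∣n; m∣m*n; >⇒∤; _∣?_)
open import Data.Nat.Primality using (Prime; euclidsLemma; ¬prime[1]; prime⇒nonZero)
open import Data.Integer.Base as ℤ using (ℤ; -[1+_])
import Data.Integer.Properties as ℤ
import Data.Integer.Divisibility.Signed as ℤ∣
open import Data.Rational using (↧ₙ_; _+_; _*_)
open import Data.Rational.Base using (ℚ; mkℚ; -_; _-_; 0ℚ; 1ℚ; _/_; 1/_; ≢-nonZero; fromℚᵘ)
open import Data.Rational.Properties
open import Data.Rational.Unnormalised.Base as ℚᵘ using (mkℚᵘ; *≡*)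
import Data.Rational.Unnormalised.Properties as ℚᵘ
open import Data.Product using (Σ; _×_; _,_)
open import Data.Sum.Base using (_⊎_; inj₁; inj₂; [_,_]′)
open import Level using (0ℓ)
open import Relation.Nullary using (¬_; Dec; yes; no; contradiction)
open import Relation.Nullary.Decidable using (dec⇒maybe)
open import Relation.Binary.PropositionalEquality
  using (_≡_; _≢_; refl; sym; trans; cong; cong₂; subst; subst₂; module ≡-Reasoning)
open import Tactic.RingSolver using (solve-∀)
open import Tactic.RingSolver.Core.AlmostCommutativeRing using (AlmostCommutativeRing; fromCommutativeRing)

-- The multiplier v is kept exact, but only v² is controlled. The product of pt + r over 0 < r < p
-- is constant modulo p² for odd p, whereas for p = 2 it is 2t + 1; its square is constant for every
-- prime, by pairing r with p - r. Since A is a sum of squares, p = 2 needs no separate case. In the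
-- carry case H_{d+j} may have p in its denominator. As d + j < 2p, this happens at most to the
-- first power; writing c(d,j) = py gives 2p c(d,j)² H = 2p² y² (pH) with pH p-integral, so one
-- congruence covers all j < p. The m-part can then be summed over all digits at once, and its sum
-- is exactly zero in ℚ. The residue argument never forms a rational function. Its two degrees
-- become independent parameters, (d!/e!) Π_{1≤r≤e} (r-t) / Π_{0≤r≤d} (r+t), and the constant terms
-- at the poles are followed through one linear factor at a time. For e < d the residues sum to
-- zero, and this closes each induction step.

ℚ-ring : AlmostCommutativeRing 0ℓ 0ℓ
ℚ-ring = fromCommutativeRing +-*-commutativeRing (λ x → dec⇒maybe (0ℚ ≟ x))

combine₀ : ∀ {x y} → x - y ≡ 0ℚ → x ≡ y
combine₀ {x} {y} e = begin
  x             ≡⟨ split x y ⟩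
  x - y + y     ≡⟨ cong (_+ y) e ⟩
  0ℚ + y        ≡⟨ +-identityˡ y ⟩
  y             ∎
  where
  open ≡-Reasoning
  split : ∀ x y → x ≡ x - y + y
  split = solve-∀ ℚ-ring

≡⇒-≡0 : ∀ {a b} → a ≡ b → a - b ≡ 0ℚ
≡⇒-≡0 {a} refl = +-inverseʳ a

-- Equalities modulo hypotheses: the last argument is a ring identity expressing
-- x - y as a combination of the differences of the two sides of the hypotheses.
combine₁ : ∀ {x y a b} u → a ≡ b → x - y ≡ u * (a - b) → x ≡ y
combine₁ u h e = combine₀ (trans e (trans (cong (u *_) (≡⇒-≡0 h)) (*-zeroʳ u)))

combine₂ : ∀ {x y a b a′ b′} u v → a ≡ b → a′ ≡ b′ →
           x - y ≡ u * (a - b) + v * (a′ - b′) → x ≡ y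
combine₂ {a′ = a′} {b′} u v h h′ e = combine₁ v h′ (trans e (drop h))
  where
  drop : ∀ {a b} → a ≡ b → u * (a - b) + v * (a′ - b′) ≡ v * (a′ - b′)
  drop {a} refl = cancel a u (v * (a′ - b′))
    where
    cancel : ∀ a u t → u * (a - a) + t ≡ t
    cancel = solve-∀ ℚ-ring

combine₃ : ∀ {x y a b a′ b′ a″ b″} u v w → a ≡ b → a′ ≡ b′ → a″ ≡ b″ →
           x - y ≡ u * (a - b) + v * (a′ - b′) + w * (a″ - b″) → x ≡ y
combine₃ {a = a} {b} {a′ = a′} {b′} u v w h h′ h″ e =
  combine₂ 1ℚ w (cong₂ (λ s t → u * s + v * t) (≡⇒-≡0 h) (≡⇒-≡0 h′)) h″
    (trans e (rearrange (u * (a - b) + v * (a′ - b′)) (w * _) u v))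
  where
  rearrange : ∀ s t u v → s + t ≡ 1ℚ * (s - (u * 0ℚ + v * 0ℚ)) + t
  rearrange = solve-∀ ℚ-ring

-- The embedding of ℤ in ℚ, and reciprocals

fromℚᵘ-homo-* : ∀ a b → fromℚᵘ a * fromℚᵘ b ≡ fromℚᵘ (a ℚᵘ.* b)
fromℚᵘ-homo-* a b = toℚᵘ-injective (ℚᵘ.≃-trans (toℚᵘ-homo-* (fromℚᵘ a) (fromℚᵘ b))
  (ℚᵘ.≃-trans (ℚᵘ.*-cong (toℚᵘ-fromℚᵘ a) (toℚᵘ-fromℚᵘ b)) (ℚᵘ.≃-sym (toℚᵘ-fromℚᵘ (a ℚᵘ.* b)))))

fromℚᵘ-homo-+ : ∀ a b → fromℚᵘ a + fromℚᵘ b ≡ fromℚᵘ (a ℚᵘ.+ b)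
fromℚᵘ-homo-+ a b = toℚᵘ-injective (ℚᵘ.≃-trans (toℚᵘ-homo-+ (fromℚᵘ a) (fromℚᵘ b))
  (ℚᵘ.≃-trans (ℚᵘ.+-cong (toℚᵘ-fromℚᵘ a) (toℚᵘ-fromℚᵘ b)) (ℚᵘ.≃-sym (toℚᵘ-fromℚᵘ (a ℚᵘ.+ b)))))

ℤ→ℚ-homo-* : ∀ a b → ℤ→ℚ (a ℤ.* b) ≡ ℤ→ℚ a * ℤ→ℚ b
ℤ→ℚ-homo-* a b = sym (fromℚᵘ-homo-* (mkℚᵘ a 0) (mkℚᵘ b 0))

ℤ→ℚ-homo-+ : ∀ a b → ℤ→ℚ (a ℤ.+ b) ≡ ℤ→ℚ a + ℤ→ℚ b
ℤ→ℚ-homo-+ a b = sym (trans (fromℚᵘ-homo-+ (mkℚᵘ a 0) (mkℚᵘ b 0))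
  (cong₂ (λ x y → ℤ→ℚ (x ℤ.+ y)) (ℤ.*-identityʳ a) (ℤ.*-identityʳ b)))

ℤ→ℚ-homo‿- : ∀ a → ℤ→ℚ (ℤ.- a) ≡ - ℤ→ℚ a
ℤ→ℚ-homo‿- a = combine₁ 1ℚ (trans (sym (ℤ→ℚ-homo-+ (ℤ.- a) a)) (cong ℤ→ℚ (ℤ.+-inverseˡ a)))
  (rearrange (ℤ→ℚ (ℤ.- a)) (ℤ→ℚ a))
  where
  rearrange : ∀ x y → x - - y ≡ 1ℚ * (x + y - 0ℚ)
  rearrange = solve-∀ ℚ-ring

ℕ→ℚ-homo-+ : ∀ m n → ℕ→ℚ (m ℕ.+ n) ≡ ℕ→ℚ m + ℕ→ℚ n
ℕ→ℚ-homo-+ m n = ℤ→ℚ-homo-+ (ℤ.+ m) (ℤ.+ n)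

ℕ→ℚ-homo-* : ∀ m n → ℕ→ℚ (m ℕ.* n) ≡ ℕ→ℚ m * ℕ→ℚ n
ℕ→ℚ-homo-* m n = trans (cong ℤ→ℚ (ℤ.pos-* m n)) (ℤ→ℚ-homo-* (ℤ.+ m) (ℤ.+ n))

ℕ→ℚ-suc : ∀ k → ℕ→ℚ (suc k) ≡ 1ℚ + ℕ→ℚ k
ℕ→ℚ-suc k = ℕ→ℚ-homo-+ 1 k

ℤ→ℚ-injective : ∀ {a b} → ℤ→ℚ a ≡ ℤ→ℚ b → a ≡ b
ℤ→ℚ-injective {a} {b} e with fromℚᵘ-injective {mkℚᵘ a 0} {mkℚᵘ b 0} e
... | *≡* q = trans (sym (ℤ.*-identityʳ a)) (trans q (ℤ.*-identityʳ b))

recip-inverse : ∀ n .{{_ : ℕ.NonZero n}} → ℕ→ℚ n * ((ℤ.+ 1) / n) ≡ 1ℚ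
recip-inverse (suc n) = trans (fromℚᵘ-homo-* (mkℚᵘ (ℤ.+ suc n) 0) (mkℚᵘ (ℤ.+ 1) n))
  (fromℚᵘ-cong {mkℚᵘ (ℤ.+ suc n) 0 ℚᵘ.* mkℚᵘ (ℤ.+ 1) n} {mkℚᵘ (ℤ.+ 1) 0}
    (*≡* (trans (cong (ℤ._* ℤ.+ 1) (ℤ.*-identityʳ (ℤ.+ suc n)))
    (trans (ℤ.*-identityʳ (ℤ.+ suc n)) (sym (trans (ℤ.*-identityˡ _) (cong (λ x → ℤ.+ suc x) (ℕ.+-identityʳ n))))))))

inverse-unique : ∀ {x a b} → x * a ≡ 1ℚ → x * b ≡ 1ℚ → a ≡ b
inverse-unique {x} {a} {b} ha hb = combine₂ b (- a) ha hb (rearrange x a b)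
  where
  rearrange : ∀ x a b → a - b ≡ b * (x * a - 1ℚ) + - a * (x * b - 1ℚ)
  rearrange = solve-∀ ℚ-ring

*-nonzero-cancelˡ : ∀ {a x} → a ≢ 0ℚ → a * x ≡ 0ℚ → x ≡ 0ℚ
*-nonzero-cancelˡ {a} {x} a≢0 e =
  let instance nz = ≢-nonZero a≢0 in
  combine₂ (- x) (1/ a) (*-inverseʳ a) e (rearrange a x (1/ a))
  where
  rearrange : ∀ a x i → x - 0ℚ ≡ - x * (a * i - 1ℚ) + i * (a * x - 0ℚ)
  rearrange = solve-∀ ℚ-ring

1/suc : ℕ → ℚ
1/suc k = (ℤ.+ 1) / suc k

1/suc-inverse : ∀ k → (1ℚ + ℕ→ℚ k) * 1/suc k ≡ 1ℚ
1/suc-inverse k = trans (cong (_* 1/suc k) (sym (ℕ→ℚ-suc k))) (recip-inverse (suc k))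

1/! : ℕ → ℚ
1/! k = ((ℤ.+ 1) / (k !)) {{k !≢0}}

1/!-suc : ∀ k → 1/! (suc k) ≡ 1/! k * 1/suc k
1/!-suc k = inverse-unique {ℕ→ℚ (suc k !)} (recip-inverse (suc k !) {{suc k !≢0}})
  (trans (cong (_* (1/! k * 1/suc k)) (ℕ→ℚ-homo-* (suc k) (k !)))
  (combine₂ (ℕ→ℚ (k !) * 1/! k) 1ℚ (recip-inverse (suc k)) (recip-inverse (k !) {{k !≢0}})
    (rearrange (ℕ→ℚ (suc k)) (ℕ→ℚ (k !)) (1/! k) (1/suc k))))
  where
  rearrange : ∀ s f i r → s * f * (i * r) - 1ℚ ≡ f * i * (s * r - 1ℚ) + 1ℚ * (f * i - 1ℚ)
  rearrange = solve-∀ ℚ-ring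

-- Finite sums

sum-cong : ∀ K {f g} → (∀ k → k ≤ K → f k ≡ g k) → sumTo K f ≡ sumTo K g
sum-cong zero    h = h 0 z≤n
sum-cong (suc K) h = cong₂ _+_ (sum-cong K (λ k k≤K → h k (ℕ.m≤n⇒m≤1+n k≤K))) (h (suc K) ℕ.≤-refl)

sum-+ : ∀ K f g → sumTo K (λ k → f k + g k) ≡ sumTo K f + sumTo K g
sum-+ zero    f g = refl
sum-+ (suc K) f g = trans (cong (_+ (f (suc K) + g (suc K))) (sum-+ K f g))
  (rearrange (sumTo K f) (sumTo K g) (f (suc K)) (g (suc K)))
  where
  rearrange : ∀ a b x y → a + b + (x + y) ≡ a + x + (b + y)
  rearrange = solve-∀ ℚ-ring

sum-*ˡ : ∀ K a f → sumTo K (λ k → a * f k) ≡ a * sumTo K f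
sum-*ˡ zero    a f = refl
sum-*ˡ (suc K) a f = trans (cong (_+ a * f (suc K)) (sum-*ˡ K a f))
  (sym (*-distribˡ-+ a (sumTo K f) (f (suc K))))

sum-zero : ∀ K {f} → (∀ k → k ≤ K → f k ≡ 0ℚ) → sumTo K f ≡ 0ℚ
sum-zero zero    h = h 0 z≤n
sum-zero (suc K) h = cong₂ _+_ (sum-zero K (λ k k≤K → h k (ℕ.m≤n⇒m≤1+n k≤K))) (h (suc K) ℕ.≤-refl)

sum-swap : ∀ K L (f : ℕ → ℕ → ℚ) →
           sumTo K (λ i → sumTo L (f i)) ≡ sumTo L (λ j → sumTo K (λ i → f i j))
sum-swap zero    L f = refl
sum-swap (suc K) L f = trans (cong (_+ sumTo L (f (suc K))) (sum-swap K L f))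
  (sym (sum-+ L (λ j → sumTo K (λ i → f i j)) (f (suc K))))

sum-suc : ∀ K f → sumTo (suc K) f ≡ f 0 + sumTo K (λ k → f (suc k))
sum-suc zero    f = refl
sum-suc (suc K) f = trans (cong (_+ f (suc (suc K))) (sum-suc K f)) (+-assoc (f 0) _ _)

sum-extend : ∀ K t {f} → (∀ k → K < k → f k ≡ 0ℚ) → sumTo (t ℕ.+ K) f ≡ sumTo K f
sum-extend K zero    h = refl
sum-extend K (suc t) h = trans (cong₂ _+_ (sum-extend K t h) (h (suc (t ℕ.+ K)) (s≤s (ℕ.m≤n+m K t))))
  (+-identityʳ _)

sum-extend-≤ : ∀ {K L f} → K ≤ L → (∀ k → K < k → f k ≡ 0ℚ) → sumTo L f ≡ sumTo K f
sum-extend-≤ {K} {L} {f} K≤L h = trans (cong (λ x → sumTo x f) (sym (ℕ.m∸n+n≡m K≤L))) (sum-extend K (L ℕ.∸ K) h)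

-- Division with remainder by `suc q`. `sumTo` includes its bound, so `suc q ℕ.* M ℕ.+ q` is the
-- last index of a complete block.
sum-blocks : ∀ q M f →
  sumTo (suc q ℕ.* M ℕ.+ q) f ≡ sumTo M (λ m → sumTo q (λ j → f (suc q ℕ.* m ℕ.+ j)))
sum-blocks q zero f = trans (cong (λ a → sumTo (a ℕ.+ q) f) (ℕ.*-zeroʳ q))
  (sum-cong q (λ j _ → cong (λ a → f (a ℕ.+ j)) (sym (ℕ.*-zeroʳ q))))
sum-blocks q (suc M) f = begin
  sumTo (suc q ℕ.* suc M ℕ.+ q) f
    ≡⟨ cong (λ a → sumTo a f) (last-block q) ⟩
  sumTo ((suc q ℕ.* M ℕ.+ q) ℕ.+ suc q) f
    ≡⟨ append (suc q ℕ.* M ℕ.+ q) q ⟩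
  sumTo (suc q ℕ.* M ℕ.+ q) f + sumTo q (λ j → f (suc (suc q ℕ.* M ℕ.+ q) ℕ.+ j))
    ≡⟨ cong₂ _+_ (sum-blocks q M f) (sum-cong q (λ j _ → cong (λ a → f (a ℕ.+ j)) (next q))) ⟩
  sumTo (suc M) (λ m → sumTo q (λ j → f (suc q ℕ.* m ℕ.+ j))) ∎
  where
  open ≡-Reasoning
  next : ∀ q → suc (suc q ℕ.* M ℕ.+ q) ≡ suc q ℕ.* suc M
  next q = trans (sym (ℕ.+-suc (suc q ℕ.* M) q)) (trans (ℕ.+-comm (suc q ℕ.* M) (suc q)) (sym (ℕ.*-suc (suc q) M)))
  last-block : ∀ q → suc q ℕ.* suc M ℕ.+ q ≡ (suc q ℕ.* M ℕ.+ q) ℕ.+ suc q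
  last-block q = trans (cong (ℕ._+ q) (sym (next q))) (sym (ℕ.+-suc (suc q ℕ.* M ℕ.+ q) q))
  append : ∀ a b → sumTo (a ℕ.+ suc b) f ≡ sumTo a f + sumTo b (λ j → f (suc a ℕ.+ j))
  append a zero    = trans (cong (λ x → sumTo x f) (ℕ.+-comm a 1))
    (cong (λ x → sumTo a f + f (suc x)) (sym (ℕ.+-identityʳ a)))
  append a (suc b) = trans (cong (λ x → sumTo x f) (ℕ.+-suc a (suc b)))
    (trans (cong₂ _+_ (append a b) refl) (+-assoc (sumTo a f) _ _))

-- 1/(i - j), with the junk value 0 on the diagonal.
1/[_-_] : ℕ → ℕ → ℚ
1/[ zero  - zero  ] = 0ℚ
1/[ suc i - zero  ] = 1/suc i
1/[ zero  - suc j ] = - 1/suc j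
1/[ suc i - suc j ] = 1/[ i - j ]

-- The Kronecker delta, by the same recursion as `1/[_-_]`; it records the defect of that inverse on
-- the diagonal.
δ : ℕ → ℕ → ℚ
δ zero    zero    = 1ℚ
δ (suc i) zero    = 0ℚ
δ zero    (suc j) = 0ℚ
δ (suc i) (suc j) = δ i j

1/[-]-antisym : ∀ i j → 1/[ j - i ] ≡ - 1/[ i - j ]
1/[-]-antisym zero    zero    = refl
1/[-]-antisym zero    (suc j) = neg-neg (1/suc j)
  where
  neg-neg : ∀ x → x ≡ - - x
  neg-neg = solve-∀ ℚ-ring
1/[-]-antisym (suc i) zero    = refl
1/[-]-antisym (suc i) (suc j) = 1/[-]-antisym i j

1/[-]-inverse : ∀ i j → (ℕ→ℚ i - ℕ→ℚ j) * 1/[ i - j ] ≡ 1ℚ - δ i j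
1/[-]-inverse zero    zero    = refl
1/[-]-inverse (suc i) zero    = trans (cong (λ x → (x - 0ℚ) * 1/suc i) (ℕ→ℚ-suc i))
  (combine₁ 1ℚ (1/suc-inverse i) (rearrange (ℕ→ℚ i) (1/suc i)))
  where
  rearrange : ∀ i r → (1ℚ + i - 0ℚ) * r - (1ℚ - 0ℚ) ≡ 1ℚ * ((1ℚ + i) * r - 1ℚ)
  rearrange = solve-∀ ℚ-ring
1/[-]-inverse zero (suc j)    = trans (cong (λ x → (0ℚ - x) * - 1/suc j) (ℕ→ℚ-suc j))
  (combine₁ 1ℚ (1/suc-inverse j) (rearrange (ℕ→ℚ j) (1/suc j)))
  where
  rearrange : ∀ i r → (0ℚ - (1ℚ + i)) * - r - (1ℚ - 0ℚ) ≡ 1ℚ * ((1ℚ + i) * r - 1ℚ)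
  rearrange = solve-∀ ℚ-ring
1/[-]-inverse (suc i) (suc j) = trans
  (cong₂ (λ x y → (x - y) * 1/[ i - j ]) (ℕ→ℚ-suc i) (ℕ→ℚ-suc j))
  (trans (rearrange (ℕ→ℚ i) (ℕ→ℚ j) 1/[ i - j ]) (1/[-]-inverse i j))
  where
  rearrange : ∀ i j r → (1ℚ + i - (1ℚ + j)) * r ≡ (i - j) * r
  rearrange = solve-∀ ℚ-ring

δ-diag : ∀ j → δ j j ≡ 1ℚ
δ-diag zero    = refl
δ-diag (suc j) = δ-diag j

δ-> : ∀ {i j} → j < i → δ i j ≡ 0ℚ
δ-> {suc i} {zero}  _         = refl
δ-> {suc i} {suc j} (s≤s j<i) = δ-> j<i

δ-< : ∀ {i j} → i < j → δ i j ≡ 0ℚ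
δ-< {zero}  {suc j} _         = refl
δ-< {suc i} {suc j} (s≤s i<j) = δ-< i<j

sum-δ : ∀ {K j} (f : ℕ → ℚ) → j ≤ K → sumTo K (λ i → f i * δ i j) ≡ f j
sum-δ {K} {j} f j≤K = trans
  (sum-extend-≤ j≤K (λ i j<i → trans (cong (f i *_) (δ-> j<i)) (*-zeroʳ (f i)))) (up-to j)
  where
  up-to : ∀ j → sumTo j (λ i → f i * δ i j) ≡ f j
  up-to zero    = *-identityʳ (f 0)
  up-to (suc j) = trans (cong₂ _+_
    (sum-zero j (λ i i≤j → trans (cong (f i *_) (δ-< (s≤s i≤j))) (*-zeroʳ (f i))))
    (trans (cong (f (suc j) *_) (δ-diag (suc j))) (*-identityʳ (f (suc j))))) (+-identityˡ (f (suc j)))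

-- With F(t) = Σ_i f i / (t+i), both sides are the constant term at t = -j of (c-t) F(t) + Σ_i f i.
-- Termwise, (c+i)/(i-j) = (c+j)/(i-j) + 1 for i ≠ j; the diagonal term is 0, which accounts for the
-- subtracted `f j`.
sum-1/[-]-shift : ∀ {K j} c (f : ℕ → ℚ) → j ≤ K →
  sumTo K (λ i → (c + ℕ→ℚ i) * f i * 1/[ i - j ]) ≡
  (c + ℕ→ℚ j) * sumTo K (λ i → f i * 1/[ i - j ]) + (sumTo K f - f j)
sum-1/[-]-shift {K} {j} c f j≤K = begin
  sumTo K (λ i → (c + ℕ→ℚ i) * f i * 1/[ i - j ])
    ≡⟨ sum-cong K (λ i _ → split i) ⟩
  sumTo K (λ i → (c + ℕ→ℚ j) * (f i * 1/[ i - j ]) + (f i + - 1ℚ * (f i * δ i j)))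
    ≡⟨ sum-+ K (λ i → (c + ℕ→ℚ j) * (f i * 1/[ i - j ])) (λ i → f i + - 1ℚ * (f i * δ i j)) ⟩
  sumTo K (λ i → (c + ℕ→ℚ j) * (f i * 1/[ i - j ])) + sumTo K (λ i → f i + - 1ℚ * (f i * δ i j))
    ≡⟨ cong₂ _+_ (sum-*ˡ K (c + ℕ→ℚ j) (λ i → f i * 1/[ i - j ]))
         (trans (sum-+ K f (λ i → - 1ℚ * (f i * δ i j))) (cong (sumTo K f +_)
           (trans (sum-*ˡ K (- 1ℚ) (λ i → f i * δ i j)) (cong (- 1ℚ *_) (sum-δ f j≤K))))) ⟩
  (c + ℕ→ℚ j) * sumTo K (λ i → f i * 1/[ i - j ]) + (sumTo K f + - 1ℚ * f j)
    ≡⟨ cong (λ x → (c + ℕ→ℚ j) * sumTo K (λ i → f i * 1/[ i - j ]) + (sumTo K f + x)) (neg (f j)) ⟩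
  (c + ℕ→ℚ j) * sumTo K (λ i → f i * 1/[ i - j ]) + (sumTo K f - f j) ∎
  where
  open ≡-Reasoning
  neg : ∀ x → - 1ℚ * x ≡ - x
  neg = solve-∀ ℚ-ring
  rearrange : ∀ c f i j r d → (c + i) * f * r - ((c + j) * (f * r) + (f + - 1ℚ * (f * d))) ≡
                              f * ((i - j) * r - (1ℚ - d))
  rearrange = solve-∀ ℚ-ring
  split : ∀ i → (c + ℕ→ℚ i) * f i * 1/[ i - j ] ≡
                (c + ℕ→ℚ j) * (f i * 1/[ i - j ]) + (f i + - 1ℚ * (f i * δ i j))
  split i = combine₁ (f i) (1/[-]-inverse i j)
    (rearrange c (f i) (ℕ→ℚ i) (ℕ→ℚ j) 1/[ i - j ] (δ i j))

-- Pochhammer symbols and contiguous relations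

poch-sucˡ : ∀ x k → poch x (suc k) ≡ x * poch (x + 1ℚ) k
poch-sucˡ x zero    = base x
  where
  base : ∀ x → 1ℚ * (x + 0ℚ) ≡ x * 1ℚ
  base = solve-∀ ℚ-ring
poch-sucˡ x (suc k) = trans (cong₂ (λ a b → a * (x + b)) (poch-sucˡ x k) (ℕ→ℚ-suc k))
  (rearrange x (poch (x + 1ℚ) k) (ℕ→ℚ k))
  where
  rearrange : ∀ x a k → x * a * (x + (1ℚ + k)) ≡ x * (a * (x + 1ℚ + k))
  rearrange = solve-∀ ℚ-ring

poch-vanish : ∀ {n k} → n < k → poch (- ℕ→ℚ n) k ≡ 0ℚ
poch-vanish {n} {suc k} (s≤s n≤k) with ℕ.m≤n⇒m<n∨m≡n n≤k
... | inj₁ n<k = trans (cong (_* (- ℕ→ℚ n + ℕ→ℚ k)) (poch-vanish n<k)) (*-zeroˡ (- ℕ→ℚ n + ℕ→ℚ k))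
... | inj₂ refl = trans (cong (poch (- ℕ→ℚ n) n *_) (+-inverseˡ (ℕ→ℚ n))) (*-zeroʳ (poch (- ℕ→ℚ n) n))

-- The coefficients of ₂F₁(x, y; 1; 1).
hyp : ℚ → ℚ → ℕ → ℚ
hyp x y k = poch x k * poch y k * 1/! k * 1/! k

hyp-comm : ∀ x y k → hyp x y k ≡ hyp y x k
hyp-comm x y k = cong (λ a → a * 1/! k * 1/! k) (*-comm (poch x k) (poch y k))

hyp-suc : ∀ x y k → hyp x y (suc k) ≡ hyp x y k * ((x + ℕ→ℚ k) * (y + ℕ→ℚ k)) * (1/suc k * 1/suc k)
hyp-suc x y k = trans (cong (λ f → poch x (suc k) * poch y (suc k) * f * f) (1/!-suc k))
  (rearrange (poch x k) (poch y k) (x + ℕ→ℚ k) (y + ℕ→ℚ k) (1/! k) (1/suc k))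
  where
  rearrange : ∀ a b x y f r → a * x * (b * y) * (f * r) * (f * r) ≡ a * b * f * f * (x * y) * (r * r)
  rearrange = solve-∀ ℚ-ring

-- Both x (x+1)_k and (x)_k (x+k) equal (x)_{k+1}.
hyp-+1ˡ : ∀ x y k → x * hyp (x + 1ℚ) y k ≡ (x + ℕ→ℚ k) * hyp x y k
hyp-+1ˡ x y k = combine₁ (poch y k * 1/! k * 1/! k) (sym (poch-sucˡ x k))
  (rearrange x (poch (x + 1ℚ) k) (poch y k) (1/! k) (poch x k) (ℕ→ℚ k))
  where
  rearrange : ∀ x a b f c k →
    x * (a * b * f * f) - (x + k) * (c * b * f * f) ≡ b * f * f * (x * a - c * (x + k))
  rearrange = solve-∀ ℚ-ring

hyp-+1ʳ : ∀ x y k → y * hyp x (y + 1ℚ) k ≡ (y + ℕ→ℚ k) * hyp x y k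
hyp-+1ʳ x y k = trans (cong (y *_) (hyp-comm x (y + 1ℚ) k))
  (trans (hyp-+1ˡ y x k) (cong ((y + ℕ→ℚ k) *_) (hyp-comm y x k)))

hyp-sucˡ : ∀ x y k → hyp x y (suc k) ≡ x * (y + ℕ→ℚ k) * (1/suc k * 1/suc k) * hyp (x + 1ℚ) y k
hyp-sucˡ x y k = trans (hyp-suc x y k)
  (combine₁ (- ((y + ℕ→ℚ k) * (1/suc k * 1/suc k))) (hyp-+1ˡ x y k)
    (rearrange x (ℕ→ℚ k) (y + ℕ→ℚ k) (1/suc k) (hyp x y k) (hyp (x + 1ℚ) y k)))
  where
  rearrange : ∀ x k y r h g → h * ((x + k) * y) * (r * r) - x * y * (r * r) * g ≡
                              - (y * (r * r)) * (x * g - (x + k) * h)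
  rearrange = solve-∀ ℚ-ring

-- The residue identity

-- For e ≤ d this is the residue at t = -i of (d!/e!) Π_{1≤r≤e} (r-t) / Π_{0≤r≤d} (r+t). The case of
-- interest is e = d; separate parameters make induction possible.
coeff : ℕ → ℕ → ℕ → ℚ
coeff d e = hyp (- ℕ→ℚ d) (ℕ→ℚ e + 1ℚ)

hyp-vanish : ∀ {d k} y → d < k → hyp (- ℕ→ℚ d) y k ≡ 0ℚ
hyp-vanish {d} {k} y d<k = trans (cong (λ a → a * poch y k * 1/! k * 1/! k) (poch-vanish d<k))
  (collapse (poch y k) (1/! k))
  where
  collapse : ∀ b f → 0ℚ * b * f * f ≡ 0ℚ
  collapse = solve-∀ ℚ-ring

-ℕ→ℚ-suc : ∀ d → - ℕ→ℚ (suc d) + 1ℚ ≡ - ℕ→ℚ d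
-ℕ→ℚ-suc d = trans (cong (λ x → - x + 1ℚ) (ℕ→ℚ-suc d)) (rearrange (ℕ→ℚ d))
  where
  rearrange : ∀ d → - (1ℚ + d) + 1ℚ ≡ - d
  rearrange = solve-∀ ℚ-ring

ℕ→ℚ-suc-+1 : ∀ e → ℕ→ℚ (suc e) + 1ℚ ≡ ℕ→ℚ e + 1ℚ + 1ℚ
ℕ→ℚ-suc-+1 e = cong (_+ 1ℚ) (trans (ℕ→ℚ-suc e) (+-comm 1ℚ (ℕ→ℚ e)))

-- Passing from d+1 to d multiplies the rational function by (d+1+t)/(d+1), taken here at t = -i. In
-- `coeff-sucᵉ`, raising e likewise multiplies it by (e+1-t)/(e+1).
coeff-sucᵈ : ∀ d e i →
  - (1ℚ + ℕ→ℚ d) * coeff d e i ≡ (- (1ℚ + ℕ→ℚ d) + ℕ→ℚ i) * coeff (suc d) e i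
coeff-sucᵈ d e i = subst₂ (λ x x′ → x′ * hyp x (ℕ→ℚ e + 1ℚ) i ≡ (x′ + ℕ→ℚ i) * coeff (suc d) e i)
  (-ℕ→ℚ-suc d) (cong -_ (ℕ→ℚ-suc d)) (hyp-+1ˡ (- ℕ→ℚ (suc d)) (ℕ→ℚ e + 1ℚ) i)

coeff-sucᵉ : ∀ d e i → (ℕ→ℚ e + 1ℚ) * coeff d (suc e) i ≡ (ℕ→ℚ e + 1ℚ + ℕ→ℚ i) * coeff d e i
coeff-sucᵉ d e i = trans (cong (λ y → (ℕ→ℚ e + 1ℚ) * hyp (- ℕ→ℚ d) y i) (ℕ→ℚ-suc-+1 e))
  (hyp-+1ʳ (- ℕ→ℚ d) (ℕ→ℚ e + 1ℚ) i)

-- The right-hand side is the Wilf–Zeilberger certificate.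
sum-hyp-telescope : ∀ x y k →
  sumTo k (λ i → x * hyp x y i + (y + x) * - hyp (x + 1ℚ) y i) ≡ - (y + ℕ→ℚ k) * hyp (x + 1ℚ) y k
sum-hyp-telescope x y zero    = base x y
  where
  base : ∀ x y → x * 1ℚ + (y + x) * - 1ℚ ≡ - (y + 0ℚ) * 1ℚ
  base = solve-∀ ℚ-ring
sum-hyp-telescope x y (suc k) = begin
  sumTo k _ + (x * hyp x y (suc k) + (y + x) * - hyp (x + 1ℚ) y (suc k))
    ≡⟨ cong₂ _+_ (sum-hyp-telescope x y k)
         (cong₂ (λ a b → x * a + (y + x) * - b) (hyp-sucˡ x y k) (hyp-suc (x + 1ℚ) y k)) ⟩
  - (y + κ) * g + (x * (x * (y + κ) * (r * r) * g) + (y + x) * - (g * ((x + 1ℚ + κ) * (y + κ)) * (r * r)))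
    -- The reciprocal r occurs squared, and (1+κ)² r² - 1 factors through (1+κ) r - 1 with cofactor
    -- (1+κ) r + 1.
    ≡⟨ combine₁ ((y + κ) * g * ((1ℚ + κ) * r + 1ℚ)) (1/suc-inverse k) (rearrange x y κ r g) ⟩
  - (y + (1ℚ + κ)) * (g * ((x + 1ℚ + κ) * (y + κ)) * (r * r))
    ≡⟨ cong₂ (λ a b → - (y + a) * b) (sym (ℕ→ℚ-suc k)) (sym (hyp-suc (x + 1ℚ) y k)) ⟩
  - (y + ℕ→ℚ (suc k)) * hyp (x + 1ℚ) y (suc k) ∎
  where
  open ≡-Reasoning
  κ r g : ℚ
  κ = ℕ→ℚ k
  r = 1/suc k
  g = hyp (x + 1ℚ) y k
  rearrange : ∀ x y κ r g →
    - (y + κ) * g + (x * (x * (y + κ) * (r * r) * g) + (y + x) * - (g * ((x + 1ℚ + κ) * (y + κ)) * (r * r)))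
      - - (y + (1ℚ + κ)) * (g * ((x + 1ℚ + κ) * (y + κ)) * (r * r))
    ≡ (y + κ) * g * ((1ℚ + κ) * r + 1ℚ) * ((1ℚ + κ) * r - 1ℚ)
  rearrange = solve-∀ ℚ-ring

1+ℕ→ℚ≢0 : ∀ d → 1ℚ + ℕ→ℚ d ≢ 0ℚ
1+ℕ→ℚ≢0 d e with () ← ℤ→ℚ-injective {ℤ.+ suc d} {ℤ.0ℤ} (trans (ℕ→ℚ-suc d) e)

-- The recurrence of the Chu-Vandermonde value (-e)_d / d!. The telescoped sum is taken up to d+1,
-- where `coeff d e` vanishes and only the two full sums remain.
sum-coeff-suc : ∀ d e →
  (1ℚ + ℕ→ℚ d) * sumTo (suc d) (coeff (suc d) e) ≡ (ℕ→ℚ d - ℕ→ℚ e) * sumTo d (coeff d e)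
sum-coeff-suc d e = combine₁ (- 1ℚ) (trans (sym linear) (trans telescoped
    (trans (cong (- (y + ℕ→ℚ (suc d)) *_) (hyp-vanish {d} y ℕ.≤-refl)) (*-zeroʳ (- (y + ℕ→ℚ (suc d)))))))
  (rearrange (ℕ→ℚ d) (ℕ→ℚ e) S S′)
  where
  x y S S′ : ℚ
  x = - (1ℚ + ℕ→ℚ d)
  y = ℕ→ℚ e + 1ℚ
  S = sumTo (suc d) (coeff (suc d) e)
  S′ = sumTo d (coeff d e)
  telescoped : sumTo (suc d) (λ i → x * coeff (suc d) e i + (y + x) * - coeff d e i) ≡
               - (y + ℕ→ℚ (suc d)) * coeff d e (suc d)
  telescoped = subst₂ (λ a b → sumTo (suc d) (λ i → b * coeff (suc d) e i + (y + b) * - hyp a y i) ≡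
                               - (y + ℕ→ℚ (suc d)) * hyp a y (suc d))
    (-ℕ→ℚ-suc d) (cong -_ (ℕ→ℚ-suc d)) (sum-hyp-telescope (- ℕ→ℚ (suc d)) y (suc d))
  linear : sumTo (suc d) (λ i → x * coeff (suc d) e i + (y + x) * - coeff d e i) ≡ x * S + - (y + x) * S′
  linear = trans (sum-+ (suc d) _ _) (cong₂ _+_ (sum-*ˡ (suc d) x (coeff (suc d) e))
    (trans (sum-cong (suc d) (λ i _ → neg (y + x) (coeff d e i)))
    (trans (sum-*ˡ (suc d) (- (y + x)) (coeff d e))
      (cong (- (y + x) *_) (sum-extend d 1 (λ k d<k → hyp-vanish {d} y d<k))))))
    where
    neg : ∀ a b → a * - b ≡ - a * b
    neg = solve-∀ ℚ-ring
  rearrange : ∀ d e S S′ → (1ℚ + d) * S - (d - e) * S′ ≡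
    - 1ℚ * (- (1ℚ + d) * S + - (e + 1ℚ + - (1ℚ + d)) * S′ - 0ℚ)
  rearrange = solve-∀ ℚ-ring

-- The factor d - e of the recurrence is zero at d = e, which kills the sum at d = e+1; every later
-- sum is a multiple of its predecessor. Hence induction on t = d - e.
sum-coeff : ∀ t e → sumTo (suc (t ℕ.+ e)) (coeff (suc (t ℕ.+ e)) e) ≡ 0ℚ
sum-coeff t e = *-nonzero-cancelˡ (1+ℕ→ℚ≢0 (t ℕ.+ e)) (trans (sum-coeff-suc (t ℕ.+ e) e) (vanish t))
  where
  vanish : ∀ t → (ℕ→ℚ (t ℕ.+ e) - ℕ→ℚ e) * sumTo (t ℕ.+ e) (coeff (t ℕ.+ e) e) ≡ 0ℚ
  vanish zero    = trans (cong (_* sumTo e (coeff e e)) (+-inverseʳ (ℕ→ℚ e))) (*-zeroˡ (sumTo e (coeff e e)))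
  vanish (suc t) = trans (cong ((ℕ→ℚ (suc t ℕ.+ e) - ℕ→ℚ e) *_) (sum-coeff t e))
    (*-zeroʳ (ℕ→ℚ (suc t ℕ.+ e) - ℕ→ℚ e))

-- For e < d the rational function is O(1/t²) at infinity, so its residues add up to zero.
sum-coeff-< : ∀ {d e} → e < d → sumTo d (coeff d e) ≡ 0ℚ
sum-coeff-< {suc d} {e} (s≤s e≤d) =
  subst (λ d → sumTo (suc d) (coeff (suc d) e) ≡ 0ℚ) (ℕ.m∸n+n≡m e≤d) (sum-coeff (d ℕ.∸ e) e)

-- The constant term of Σ_i coeff d e i / (t + i) at its pole t = -j.
pole : ℕ → ℕ → ℕ → ℚ
pole d e j = sumTo d (λ i → coeff d e i * 1/[ i - j ])

pole-term-vanish : ∀ d e j k → d < k → coeff d e k * 1/[ k - j ] ≡ 0ℚ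
pole-term-vanish d e j k d<k = trans (cong (_* 1/[ k - j ]) (hyp-vanish (ℕ→ℚ e + 1ℚ) d<k)) (*-zeroˡ 1/[ k - j ])

-- Here -H_d is the logarithmic derivative of Π_{1≤r≤d} (r+t)⁻¹ at t = 0. In the induction,
-- `coeff d 0` is a linear factor times `coeff (suc d) 0`, so the shift formula relates the two
-- constant terms.
pole-₀₀ : ∀ d → pole d 0 0 ≡ - H d
pole-₀₀ zero    = refl
pole-₀₀ (suc d) = begin
  E′   ≡⟨ combine₃ r (pole d 0 0 - E′) 1ℚ shifted (1/suc-inverse d) (pole-₀₀ d)
           (rearrange (ℕ→ℚ d) r E′ (pole d 0 0) (H d)) ⟩
  - (H d + r) ∎
  where
  open ≡-Reasoning
  r E′ x : ℚ
  rearrange : ∀ d r e p h → e - - (h + r) ≡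
    r * (- (1ℚ + d) * p - ((- (1ℚ + d) + 0ℚ) * e + (0ℚ - 1ℚ))) + (p - e) * ((1ℚ + d) * r - 1ℚ) + 1ℚ * (p - - h)
  rearrange = solve-∀ ℚ-ring
  r = 1/suc d
  x = - (1ℚ + ℕ→ℚ d)
  E′ = pole (suc d) 0 0
  shifted : x * pole d 0 0 ≡ (x + 0ℚ) * E′ + (0ℚ - 1ℚ)
  shifted = begin
    x * pole d 0 0
      ≡⟨ cong (x *_) (sym (sum-extend d 1 (pole-term-vanish d 0 0))) ⟩
    x * sumTo (suc d) (λ i → coeff d 0 i * 1/[ i - 0 ])
      ≡⟨ sum-*ˡ (suc d) x _ ⟨
    sumTo (suc d) (λ i → x * (coeff d 0 i * 1/[ i - 0 ]))
      ≡⟨ sum-cong (suc d) (λ i _ → trans (sym (*-assoc x (coeff d 0 i) 1/[ i - 0 ]))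
           (cong (_* 1/[ i - 0 ]) (coeff-sucᵈ d 0 i))) ⟩
    sumTo (suc d) (λ i → (x + ℕ→ℚ i) * coeff (suc d) 0 i * 1/[ i - 0 ])
      ≡⟨ sum-1/[-]-shift {suc d} {0} x (coeff (suc d) 0) z≤n ⟩
    (x + 0ℚ) * E′ + (sumTo (suc d) (coeff (suc d) 0) - 1ℚ)
      ≡⟨ cong (λ s → (x + 0ℚ) * E′ + (s - 1ℚ)) (sum-coeff-< {suc d} {0} (s≤s z≤n)) ⟩
    (x + 0ℚ) * E′ + (0ℚ - 1ℚ) ∎

-- For e = 0 the functions satisfy F_{d+1}(t) = (d+1) F_d(t+1) / t; this compares residues at t =
-- -(i+1).
coeff-₀-suc : ∀ d i → coeff (suc d) 0 (suc i) ≡ - (1ℚ + ℕ→ℚ d) * 1/suc i * coeff d 0 i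
coeff-₀-suc d i = trans
  (subst₂ (λ x x′ → coeff (suc d) 0 (suc i) ≡ x′ * (1ℚ + ℕ→ℚ i) * (1/suc i * 1/suc i) * hyp x 1ℚ i)
    (-ℕ→ℚ-suc d) (cong -_ (ℕ→ℚ-suc d)) (hyp-sucˡ (- ℕ→ℚ (suc d)) 1ℚ i))
  (combine₁ (- (1ℚ + ℕ→ℚ d) * 1/suc i * coeff d 0 i) (1/suc-inverse i)
    (rearrange (- (1ℚ + ℕ→ℚ d)) (ℕ→ℚ i) (1/suc i) (coeff d 0 i)))
  where
  rearrange : ∀ x i r g → x * (1ℚ + i) * (r * r) * g - x * r * g ≡ x * r * g * ((1ℚ + i) * r - 1ℚ)
  rearrange = solve-∀ ℚ-ring

-- The translation t ↦ t+1 lowers d and j together until the pole is at 0. The term i = 0 is split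
-- off because it belongs to the new factor 1/t.
pole-₀ : ∀ {d j} → j ≤ d → pole d 0 j ≡ - (coeff d 0 j * (H (d ℕ.∸ j) - H j))
pole-₀ {d} {zero} _ = trans (pole-₀₀ d) (rearrange (H d))
  where
  rearrange : ∀ h → - h ≡ - (1ℚ * (h - 0ℚ))
  rearrange = solve-∀ ℚ-ring
pole-₀ {suc d} {suc j} (s≤s j≤d) = begin
  pole (suc d) 0 (suc j)
    ≡⟨ sum-suc d (λ i → coeff (suc d) 0 i * 1/[ i - suc j ]) ⟩
  1ℚ * - r + X
    ≡⟨ combine₃ (- r) (- X) h shifted (1/suc-inverse j) (coeff-₀-suc d j)
         (rearrange D (ℕ→ℚ j) r g X g′ (H (d ℕ.∸ j)) (H j)) ⟩
  - (g′ * (H (d ℕ.∸ j) - (H j + r))) ∎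
  where
  open ≡-Reasoning
  D r g g′ h X : ℚ
  D = 1ℚ + ℕ→ℚ d
  r = 1/suc j
  g = coeff d 0 j
  g′ = coeff (suc d) 0 (suc j)
  h = H (d ℕ.∸ j) - H j
  X = sumTo d (λ i → coeff (suc d) 0 (suc i) * 1/[ i - j ])
  cancel-suc : ∀ i → - D * coeff d 0 i ≡ (1ℚ + ℕ→ℚ i) * coeff (suc d) 0 (suc i)
  cancel-suc i = combine₂ (D * coeff d 0 i) (- (1ℚ + ℕ→ℚ i)) (1/suc-inverse i) (coeff-₀-suc d i)
    (expand D (ℕ→ℚ i) (1/suc i) (coeff d 0 i) (coeff (suc d) 0 (suc i)))
    where
    expand : ∀ D i r g g′ → - D * g - (1ℚ + i) * g′ ≡ D * g * ((1ℚ + i) * r - 1ℚ) + - (1ℚ + i) * (g′ - - D * r * g)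
    expand = solve-∀ ℚ-ring
  -- All residues sum to 0 and the one at i = 0 is 1.
  sum-tail : sumTo d (λ i → coeff (suc d) 0 (suc i)) ≡ - 1ℚ
  sum-tail = combine₁ 1ℚ (trans (sym (sum-suc d (coeff (suc d) 0))) (sum-coeff-< {suc d} {0} (s≤s z≤n)))
    (expand (sumTo d (λ i → coeff (suc d) 0 (suc i))))
    where
    expand : ∀ s → s - - 1ℚ ≡ 1ℚ * (1ℚ + s - 0ℚ)
    expand = solve-∀ ℚ-ring
  shifted : D * (g * h) ≡ (1ℚ + ℕ→ℚ j) * X + (- 1ℚ - g′)
  shifted = begin
    D * (g * h)
      ≡⟨ neg D (g * h) ⟩
    - D * - (g * h)
      ≡⟨ cong (- D *_) (sym (pole-₀ {d} {j} j≤d)) ⟩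
    - D * pole d 0 j
      ≡⟨ sum-*ˡ d (- D) _ ⟨
    sumTo d (λ i → - D * (coeff d 0 i * 1/[ i - j ]))
      ≡⟨ sum-cong d (λ i _ → trans (sym (*-assoc (- D) (coeff d 0 i) 1/[ i - j ]))
           (cong (_* 1/[ i - j ]) (cancel-suc i))) ⟩
    sumTo d (λ i → (1ℚ + ℕ→ℚ i) * coeff (suc d) 0 (suc i) * 1/[ i - j ])
      ≡⟨ sum-1/[-]-shift 1ℚ (λ i → coeff (suc d) 0 (suc i)) j≤d ⟩
    (1ℚ + ℕ→ℚ j) * X + (sumTo d (λ i → coeff (suc d) 0 (suc i)) - g′)
      ≡⟨ cong (λ s → (1ℚ + ℕ→ℚ j) * X + (s - g′)) sum-tail ⟩
    (1ℚ + ℕ→ℚ j) * X + (- 1ℚ - g′) ∎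
    where
    neg : ∀ a b → a * b ≡ - a * - b
    neg = solve-∀ ℚ-ring
  rearrange : ∀ D j r g X g′ hd hj → 1ℚ * - r + X - - (g′ * (hd - (hj + r))) ≡
    - r * (D * (g * (hd - hj)) - ((1ℚ + j) * X + (- 1ℚ - g′))) + - X * ((1ℚ + j) * r - 1ℚ)
      + (hd - hj) * (g′ - - D * r * g)
  rearrange = solve-∀ ℚ-ring

-- For e ≤ d and j ≤ d, minus the logarithmic derivative at t = -j of (t+j) F(t), where F is the
-- rational function with residues `coeff d e`.
harmonics : ℕ → ℕ → ℕ → ℚ
harmonics d e j = H (e ℕ.+ j) + H (d ℕ.∸ j) - (H j + H j)

-- Induction on e with d fixed: the new factor (e+1-t)/(e+1) adds 1/(e+1+j) to the harmonic part.
-- Each step starts from e < d, so the sum of the residues in the shift formula is zero.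
pole-value : ∀ {d j} e → e ≤ d → j ≤ d → pole d e j ≡ - (coeff d e j * harmonics d e j)
pole-value {d} {j} zero _ j≤d = trans (pole-₀ {d} {j} j≤d)
  (rearrange (coeff d 0 j) (H j) (H (d ℕ.∸ j)))
  where
  rearrange : ∀ g h h′ → - (g * (h′ - h)) ≡ - (g * (h + h′ - (h + h)))
  rearrange = solve-∀ ℚ-ring
pole-value {d} {j} (suc e) e<d j≤d =
  combine₁ 1ℚ (*-nonzero-cancelˡ (1+ℕ→ℚ≢0 e) scaled) (rearrange T′ (g′ * harmonics d (suc e) j))
  where
  open ≡-Reasoning
  y r g g′ h T T′ : ℚ
  y = ℕ→ℚ e + 1ℚ
  r = 1/suc (e ℕ.+ j)
  g = coeff d e j
  g′ = coeff d (suc e) j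
  h = harmonics d e j
  T = pole d e j
  T′ = pole d (suc e) j
  shifted : y * T′ ≡ (y + ℕ→ℚ j) * T + (0ℚ - g)
  shifted = begin
    y * T′
      ≡⟨ sum-*ˡ d y _ ⟨
    sumTo d (λ i → y * (coeff d (suc e) i * 1/[ i - j ]))
      ≡⟨ sum-cong d (λ i _ → trans (sym (*-assoc y (coeff d (suc e) i) 1/[ i - j ]))
           (cong (_* 1/[ i - j ]) (coeff-sucᵉ d e i))) ⟩
    sumTo d (λ i → (y + ℕ→ℚ i) * coeff d e i * 1/[ i - j ])
      ≡⟨ sum-1/[-]-shift y (coeff d e) j≤d ⟩
    (y + ℕ→ℚ j) * T + (sumTo d (coeff d e) - g)
      ≡⟨ cong (λ s → (y + ℕ→ℚ j) * T + (s - g)) (sum-coeff-< e<d) ⟩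
    (y + ℕ→ℚ j) * T + (0ℚ - g) ∎
  inverse : (1ℚ + (ℕ→ℚ e + ℕ→ℚ j)) * r ≡ 1ℚ
  inverse = trans (cong (λ x → (1ℚ + x) * r) (sym (ℕ→ℚ-homo-+ e j))) (1/suc-inverse (e ℕ.+ j))
  rearrange : ∀ t x → t - - x ≡ 1ℚ * (t + x - 0ℚ)
  rearrange = solve-∀ ℚ-ring
  expand : ∀ e j r g g′ T T′ a b c →
    (1ℚ + e) * (T′ + g′ * (a + r + b - (c + c))) - g * ((1ℚ + (e + j)) * r - 1ℚ) ≡
    1ℚ * ((e + 1ℚ) * T′ - ((e + 1ℚ + j) * T + (0ℚ - g)))
      + (e + 1ℚ + j) * (T - - (g * (a + b - (c + c))))
      + (a + r + b - (c + c)) * ((e + 1ℚ) * g′ - (e + 1ℚ + j) * g)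
  expand = solve-∀ ℚ-ring
  scaled : (1ℚ + ℕ→ℚ e) * (T′ + g′ * harmonics d (suc e) j) ≡ 0ℚ
  scaled = trans
    (combine₃ 1ℚ (y + ℕ→ℚ j) (harmonics d (suc e) j) shifted
      (pole-value {d} {j} e (ℕ.<⇒≤ e<d) j≤d) (coeff-sucᵉ d e j)
      (expand (ℕ→ℚ e) (ℕ→ℚ j) r g g′ T T′ (H (e ℕ.+ j)) (H (d ℕ.∸ j)) (H j)))
    (trans (cong (g *_) (≡⇒-≡0 inverse)) (*-zeroʳ g))

antisymmetric-sum : ∀ K (f : ℕ → ℕ → ℚ) → (∀ i j → f i j ≡ - f j i) →
                    sumTo K (λ j → sumTo K (f j)) ≡ 0ℚ
antisymmetric-sum K f anti = *-nonzero-cancelˡ 2≢0 (combine₁ 1ℚ self-opposite (rearrange X))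
  where
  X : ℚ
  X = sumTo K (λ j → sumTo K (f j))
  2≢0 : 1ℚ + 1ℚ ≢ 0ℚ
  2≢0 ()
  neg : ∀ x → - x ≡ - 1ℚ * x
  neg = solve-∀ ℚ-ring
  self-opposite : X ≡ - 1ℚ * X
  self-opposite = trans (sum-cong K (λ j _ → trans
      (sum-cong K (λ i _ → trans (anti j i) (neg (f i j)))) (sum-*ˡ K (- 1ℚ) (λ i → f i j))))
    (trans (sum-*ˡ K (- 1ℚ) (λ j → sumTo K (λ i → f i j))) (cong (- 1ℚ *_) (sym (sum-swap K K f))))
  rearrange : ∀ x → (1ℚ + 1ℚ) * x - 0ℚ ≡ 1ℚ * (x - - 1ℚ * x)
  rearrange = solve-∀ ℚ-ring

sum-harmonics : ∀ d → sumTo d (λ j → coeff d d j * coeff d d j * harmonics d d j) ≡ 0ℚ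
sum-harmonics d = begin
  sumTo d (λ j → c j * c j * harmonics d d j)
    ≡⟨ sum-cong d (λ j j≤d → trans
         (combine₁ (- c j) (sym (pole-value {d} {j} d ℕ.≤-refl j≤d)) (rearrange (c j) (harmonics d d j) (pole d d j)))
         (trans (sym (sum-*ˡ d (- c j) _)) refl)) ⟩
  sumTo d (λ j → sumTo d (λ i → - c j * (c i * 1/[ i - j ])))
    ≡⟨ antisymmetric-sum d (λ j i → - c j * (c i * 1/[ i - j ])) anti ⟩
  0ℚ ∎
  where
  open ≡-Reasoning
  c : ℕ → ℚ
  c = coeff d d
  rearrange : ∀ c h p → c * c * h - - c * p ≡ - c * (- (c * h) - p)
  rearrange = solve-∀ ℚ-ring
  anti : ∀ j i → - c j * (c i * 1/[ i - j ]) ≡ - (- c i * (c j * 1/[ j - i ]))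
  anti j i = trans (cong (λ r → - c j * (c i * r)) (1/[-]-antisym j i)) (swap (c i) (c j) 1/[ j - i ])
    where
    swap : ∀ a b r → - b * (a * - r) ≡ - (- a * (b * r))
    swap = solve-∀ ℚ-ring

-- Binomial coefficients and p-integrality

c : ℚ → ℕ → ℚ
c z = hyp (- z) (z + 1ℚ)

sgn : ℕ → ℚ
sgn zero    = 1ℚ
sgn (suc k) = - sgn k

sgn² : ∀ k → sgn k * sgn k ≡ 1ℚ
sgn² zero    = refl
sgn² (suc k) = trans (neg² (sgn k)) (sgn² k)
  where
  neg² : ∀ x → - x * - x ≡ x * x
  neg² = solve-∀ ℚ-ring

ℕ→ℚ-pascal : ∀ n k → ℕ→ℚ (suc n C suc k) ≡ ℕ→ℚ (n C k) + ℕ→ℚ (n C suc k)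
ℕ→ℚ-pascal n k = trans (cong ℕ→ℚ (sym (nCk+nC[k+1]≡[n+1]C[k+1] n k))) (ℕ→ℚ-homo-+ (n C k) (n C suc k))

-- Pascal's rule is (-n-1)_{k+1} = (-n)_{k+1} - (k+1) (-n)_k divided by (k+1)!. With `poch-C⁺` it
-- shows that c takes integer values at integers despite its denominator k!².
poch-C⁻ : ∀ n k → poch (- ℕ→ℚ n) k * 1/! k ≡ sgn k * ℕ→ℚ (n C k)
poch-C⁻ n zero = refl
poch-C⁻ zero (suc k) = trans (cong (_* 1/! (suc k)) (poch-vanish {0} {suc k} (s≤s z≤n)))
  (trans (*-zeroˡ (1/! (suc k))) (sym (trans (cong (λ x → sgn (suc k) * ℕ→ℚ x) (k>n⇒nCk≡0 {0} {suc k} (s≤s z≤n)))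
    (*-zeroʳ (sgn (suc k))))))
poch-C⁻ (suc n) (suc k) = begin
  poch (- ℕ→ℚ (suc n)) (suc k) * 1/! (suc k)
    ≡⟨ cong₂ _*_ (trans (poch-sucˡ (- ℕ→ℚ (suc n)) k)
         (cong₂ (λ x y → - x * poch y k) (ℕ→ℚ-suc n) (-ℕ→ℚ-suc n))) (1/!-suc k) ⟩
  - (1ℚ + ν) * a * (f * r)
    ≡⟨ combine₁ (- (a * f)) (1/suc-inverse k) (rearrange ν κ a f r) ⟩
  a * (- ν + κ) * (f * r) - a * f
    ≡⟨ cong₂ _-_ (trans (cong (a * (- ν + κ) *_) (sym (1/!-suc k))) (poch-C⁻ n (suc k))) (poch-C⁻ n k) ⟩
  - sgn k * ℕ→ℚ (n C suc k) - sgn k * ℕ→ℚ (n C k)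
    ≡⟨ collect (sgn k) (ℕ→ℚ (n C suc k)) (ℕ→ℚ (n C k)) ⟩
  - sgn k * (ℕ→ℚ (n C k) + ℕ→ℚ (n C suc k))
    ≡⟨ cong (- sgn k *_) (sym (ℕ→ℚ-pascal n k)) ⟩
  - sgn k * ℕ→ℚ (suc n C suc k) ∎
  where
  open ≡-Reasoning
  ν κ a f r : ℚ
  ν = ℕ→ℚ n
  κ = ℕ→ℚ k
  a = poch (- ν) k
  f = 1/! k
  r = 1/suc k
  rearrange : ∀ ν κ a f r → - (1ℚ + ν) * a * (f * r) - (a * (- ν + κ) * (f * r) - a * f) ≡
                            - (a * f) * ((1ℚ + κ) * r - 1ℚ)
  rearrange = solve-∀ ℚ-ring
  collect : ∀ s x y → - s * x - s * y ≡ - s * (y + x)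
  collect = solve-∀ ℚ-ring

-- Pascal's rule again, from (n+2)_{k+1} = (k+1) (n+2)_k + (n+1)_{k+1}.
poch-C⁺ : ∀ n k → poch (ℕ→ℚ n + 1ℚ) k * 1/! k ≡ ℕ→ℚ ((n ℕ.+ k) C k)
poch-C⁺ n zero = refl
poch-C⁺ zero (suc k) = begin
  a * (1ℚ + ℕ→ℚ k) * 1/! (suc k)
    ≡⟨ cong (a * (1ℚ + ℕ→ℚ k) *_) (1/!-suc k) ⟩
  a * (1ℚ + ℕ→ℚ k) * (1/! k * 1/suc k)
    ≡⟨ combine₁ (a * 1/! k) (1/suc-inverse k) (rearrange a (ℕ→ℚ k) (1/! k) (1/suc k)) ⟩
  a * 1/! k
    ≡⟨ poch-C⁺ zero k ⟩
  ℕ→ℚ (k C k)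
    ≡⟨ cong ℕ→ℚ (trans (nCn≡1 k) (sym (nCn≡1 (suc k)))) ⟩
  ℕ→ℚ (suc k C suc k) ∎
  where
  open ≡-Reasoning
  a : ℚ
  a = poch (0ℚ + 1ℚ) k
  rearrange : ∀ a κ f r → a * (1ℚ + κ) * (f * r) - a * f ≡ a * f * ((1ℚ + κ) * r - 1ℚ)
  rearrange = solve-∀ ℚ-ring
poch-C⁺ (suc n) (suc k) = begin
  b * (ℕ→ℚ (suc n) + 1ℚ + κ) * 1/! (suc k)
    ≡⟨ cong₂ (λ x y → b * (x + κ) * y) (ℕ→ℚ-suc-+1 n) (1/!-suc k) ⟩
  b * (ν + 1ℚ + 1ℚ + κ) * (f * r)
    ≡⟨ combine₂ (b * f) (- (f * r)) (1/suc-inverse k) left (rearrange ν κ (poch (ν + 1ℚ) (suc k)) b f r) ⟩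
  b * f + poch (ν + 1ℚ) (suc k) * (f * r)
    ≡⟨ cong₂ _+_ (poch-C⁺ (suc n) k) (trans (cong (poch (ν + 1ℚ) (suc k) *_) (sym (1/!-suc k))) (poch-C⁺ n (suc k))) ⟩
  ℕ→ℚ (suc (n ℕ.+ k) C k) + ℕ→ℚ ((n ℕ.+ suc k) C suc k)
    ≡⟨ cong (λ x → ℕ→ℚ (x C k) + ℕ→ℚ ((n ℕ.+ suc k) C suc k)) (sym (ℕ.+-suc n k)) ⟩
  ℕ→ℚ ((n ℕ.+ suc k) C k) + ℕ→ℚ ((n ℕ.+ suc k) C suc k)
    ≡⟨ sym (ℕ→ℚ-pascal (n ℕ.+ suc k) k) ⟩
  ℕ→ℚ ((suc n ℕ.+ suc k) C suc k) ∎
  where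
  open ≡-Reasoning
  ν κ b f r : ℚ
  ν = ℕ→ℚ n
  κ = ℕ→ℚ k
  b = poch (ℕ→ℚ (suc n) + 1ℚ) k
  f = 1/! k
  r = 1/suc k
  left : poch (ν + 1ℚ) (suc k) ≡ (ν + 1ℚ) * b
  left = trans (poch-sucˡ (ν + 1ℚ) k) (cong (λ y → (ν + 1ℚ) * poch y k) (sym (ℕ→ℚ-suc-+1 n)))
  rearrange : ∀ ν κ a b f r → b * (ν + 1ℚ + 1ℚ + κ) * (f * r) - (b * f + a * (f * r)) ≡
                              b * f * ((1ℚ + κ) * r - 1ℚ) + - (f * r) * (a - (ν + 1ℚ) * b)
  rearrange = solve-∀ ℚ-ring

c-ℕ : ∀ n k → c (ℕ→ℚ n) k ≡ sgn k * ℕ→ℚ ((n C k) ℕ.* ((n ℕ.+ k) C k))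
c-ℕ n k = begin
  hyp (- ℕ→ℚ n) (ℕ→ℚ n + 1ℚ) k
    ≡⟨ regroup (poch (- ℕ→ℚ n) k) (poch (ℕ→ℚ n + 1ℚ) k) (1/! k) ⟩
  poch (- ℕ→ℚ n) k * 1/! k * (poch (ℕ→ℚ n + 1ℚ) k * 1/! k)
    ≡⟨ cong₂ _*_ (poch-C⁻ n k) (poch-C⁺ n k) ⟩
  sgn k * ℕ→ℚ (n C k) * ℕ→ℚ ((n ℕ.+ k) C k)
    ≡⟨ *-assoc (sgn k) _ _ ⟩
  sgn k * (ℕ→ℚ (n C k) * ℕ→ℚ ((n ℕ.+ k) C k))
    ≡⟨ cong (sgn k *_) (sym (ℕ→ℚ-homo-* (n C k) ((n ℕ.+ k) C k))) ⟩
  sgn k * ℕ→ℚ ((n C k) ℕ.* ((n ℕ.+ k) C k)) ∎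
  where
  open ≡-Reasoning
  regroup : ∀ a b f → a * b * f * f ≡ a * f * (b * f)
  regroup = solve-∀ ℚ-ring

ℕ→ℚ-square : ∀ a → ℕ→ℚ (a ^ 2) ≡ ℕ→ℚ a * ℕ→ℚ a
ℕ→ℚ-square a = trans (cong (λ x → ℕ→ℚ (a ℕ.* x)) (ℕ.*-identityʳ a)) (ℕ→ℚ-homo-* a a)

c²-ℕ : ∀ n k → ℕ→ℚ (((n C k) ^ 2) ℕ.* (((n ℕ.+ k) C k) ^ 2)) ≡ c (ℕ→ℚ n) k * c (ℕ→ℚ n) k
c²-ℕ n k = begin
  ℕ→ℚ ((a ^ 2) ℕ.* (b ^ 2))
    ≡⟨ trans (ℕ→ℚ-homo-* (a ^ 2) (b ^ 2)) (cong₂ _*_ (ℕ→ℚ-square a) (ℕ→ℚ-square b)) ⟩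
  ℕ→ℚ a * ℕ→ℚ a * (ℕ→ℚ b * ℕ→ℚ b)
    ≡⟨ combine₁ (- (ℕ→ℚ a * ℕ→ℚ a * (ℕ→ℚ b * ℕ→ℚ b))) (sgn² k) (rearrange (sgn k) (ℕ→ℚ a) (ℕ→ℚ b)) ⟩
  sgn k * (ℕ→ℚ a * ℕ→ℚ b) * (sgn k * (ℕ→ℚ a * ℕ→ℚ b))
    ≡⟨ cong (λ x → x * x) (sym (trans (c-ℕ n k) (cong (sgn k *_) (ℕ→ℚ-homo-* a b)))) ⟩
  c (ℕ→ℚ n) k * c (ℕ→ℚ n) k ∎
  where
  open ≡-Reasoning
  a b : ℕ
  a = n C k
  b = (n ℕ.+ k) C k
  rearrange : ∀ s a b → a * a * (b * b) - s * (a * b) * (s * (a * b)) ≡ - (a * a * (b * b)) * (s * s - 1ℚ)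
  rearrange = solve-∀ ℚ-ring

-- The reflection z ↦ -1-z exchanges the arguments -z and z+1 of the two Pochhammer symbols.
c-neg : ∀ n k → c (ℤ→ℚ -[1+ n ]) k ≡ c (ℕ→ℚ n) k
c-neg n k = trans (hyp-comm (- ℤ→ℚ -[1+ n ]) (ℤ→ℚ -[1+ n ] + 1ℚ) k)
  (cong₂ (λ x y → hyp x y k) (-ℕ→ℚ-suc n)
    (trans (neg-neg (ℕ→ℚ (suc n))) (trans (ℕ→ℚ-suc n) (+-comm 1ℚ (ℕ→ℚ n)))))
  where
  neg-neg : ∀ x → - - x ≡ x
  neg-neg = solve-∀ ℚ-ring

c-vanish : ∀ z k → ℤ.∣ z ∣ < k → c (ℤ→ℚ z) k ≡ 0ℚ
c-vanish (ℤ.+ n)  k n<k = hyp-vanish (ℕ→ℚ n + 1ℚ) n<k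
c-vanish -[1+ n ] k n<k = trans (c-neg n k) (hyp-vanish (ℕ→ℚ n + 1ℚ) (ℕ.<⇒≤ n<k))

-- The bound is left free so that the sum can be prolonged by zeros to the end of a block of p
-- terms.
A-as-sum : ∀ z {K} → ℤ.∣ z ∣ ≤ K → sumTo K (λ k → c (ℤ→ℚ z) k * c (ℤ→ℚ z) k) ≡ A z
A-as-sum z ∣z∣≤K = trans
  (sum-extend-≤ ∣z∣≤K (λ k ∣z∣<k → trans (cong (λ x → x * x) (c-vanish z k ∣z∣<k)) refl))
  (sum-cong ℤ.∣ z ∣ (λ k _ → regroup (poch (- ℤ→ℚ z) k) (poch (ℤ→ℚ z + 1ℚ) k) (1/! k)))
  where
  regroup : ∀ a b f → a * b * f * f * (a * b * f * f) ≡ a * a * b * b * f * f * f * f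
  regroup = solve-∀ ℚ-ring

module PAdic (p : ℕ) (p-prime : Prime p) where

  -- Membership in ℤ_(p), witnessed by a fraction that may be unreduced, so that sums and products
  -- need no gcd. Lowest terms enter only in `integral⇒p∤↧`.
  record Integral (x : ℚ) : Set where
    constructor integral
    field
      num   : ℤ
      den   : ℕ
      p∤den : ¬ p ∣ den
      x*den : x * ℕ→ℚ den ≡ ℤ→ℚ num

  p∤1 : ¬ p ∣ 1
  p∤1 p∣1 = ¬prime[1] (subst Prime (∣1⇒≡1 p∣1) p-prime)

  p∤* : ∀ {a b} → ¬ p ∣ a → ¬ p ∣ b → ¬ p ∣ a ℕ.* b
  p∤* {a} {b} p∤a p∤b p∣ab with euclidsLemma a b p-prime p∣ab
  ... | inj₁ p∣a = p∤a p∣a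
  ... | inj₂ p∣b = p∤b p∣b

  ℤ-integral : ∀ z → Integral (ℤ→ℚ z)
  ℤ-integral z = integral z 1 p∤1 (*-identityʳ (ℤ→ℚ z))

  ℕ-integral : ∀ n → Integral (ℕ→ℚ n)
  ℕ-integral n = ℤ-integral (ℤ.+ n)

  *-integral : ∀ {x y} → Integral x → Integral y → Integral (x * y)
  *-integral {x} {y} (integral a b p∤b xb) (integral a′ b′ p∤b′ yb′) =
    integral (a ℤ.* a′) (b ℕ.* b′) (p∤* p∤b p∤b′) (begin
      x * y * ℕ→ℚ (b ℕ.* b′)         ≡⟨ cong (x * y *_) (ℕ→ℚ-homo-* b b′) ⟩
      x * y * (ℕ→ℚ b * ℕ→ℚ b′)       ≡⟨ regroup x y (ℕ→ℚ b) (ℕ→ℚ b′) ⟩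
      x * ℕ→ℚ b * (y * ℕ→ℚ b′)       ≡⟨ cong₂ _*_ xb yb′ ⟩
      ℤ→ℚ a * ℤ→ℚ a′                 ≡⟨ ℤ→ℚ-homo-* a a′ ⟨
      ℤ→ℚ (a ℤ.* a′)                 ∎)
    where
    open ≡-Reasoning
    regroup : ∀ x y b b′ → x * y * (b * b′) ≡ x * b * (y * b′)
    regroup = solve-∀ ℚ-ring

  +-integral : ∀ {x y} → Integral x → Integral y → Integral (x + y)
  +-integral {x} {y} (integral a b p∤b xb) (integral a′ b′ p∤b′ yb′) =
    integral (a ℤ.* ℤ.+ b′ ℤ.+ a′ ℤ.* ℤ.+ b) (b ℕ.* b′) (p∤* p∤b p∤b′) (begin
      (x + y) * ℕ→ℚ (b ℕ.* b′)                       ≡⟨ cong ((x + y) *_) (ℕ→ℚ-homo-* b b′) ⟩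
      (x + y) * (ℕ→ℚ b * ℕ→ℚ b′)                     ≡⟨ regroup x y (ℕ→ℚ b) (ℕ→ℚ b′) ⟩
      x * ℕ→ℚ b * ℕ→ℚ b′ + y * ℕ→ℚ b′ * ℕ→ℚ b        ≡⟨ cong₂ (λ s t → s * ℕ→ℚ b′ + t * ℕ→ℚ b) xb yb′ ⟩
      ℤ→ℚ a * ℕ→ℚ b′ + ℤ→ℚ a′ * ℕ→ℚ b                ≡⟨ cong₂ _+_ (ℤ→ℚ-homo-* a (ℤ.+ b′)) (ℤ→ℚ-homo-* a′ (ℤ.+ b)) ⟨
      ℤ→ℚ (a ℤ.* ℤ.+ b′) + ℤ→ℚ (a′ ℤ.* ℤ.+ b)        ≡⟨ ℤ→ℚ-homo-+ (a ℤ.* ℤ.+ b′) (a′ ℤ.* ℤ.+ b) ⟨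
      ℤ→ℚ (a ℤ.* ℤ.+ b′ ℤ.+ a′ ℤ.* ℤ.+ b)            ∎)
    where
    open ≡-Reasoning
    regroup : ∀ x y b b′ → (x + y) * (b * b′) ≡ x * b * b′ + y * b′ * b
    regroup = solve-∀ ℚ-ring

  neg-integral : ∀ {x} → Integral x → Integral (- x)
  neg-integral {x} x-int = subst Integral (neg x) (*-integral (ℤ-integral ℤ.-1ℤ) x-int)
    where
    neg : ∀ x → - 1ℚ * x ≡ - x
    neg = solve-∀ ℚ-ring

  -‿integral : ∀ {x y} → Integral x → Integral y → Integral (x - y)
  -‿integral x-int y-int = +-integral x-int (neg-integral y-int)

  sum-integral : ∀ K {f} → (∀ k → k ≤ K → Integral (f k)) → Integral (sumTo K f)
  sum-integral zero    h = h 0 z≤n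
  sum-integral (suc K) h = +-integral (sum-integral K (λ k k≤K → h k (ℕ.m≤n⇒m≤1+n k≤K))) (h (suc K) ℕ.≤-refl)

  1/suc-integral : ∀ {k} → ¬ p ∣ suc k → Integral (1/suc k)
  1/suc-integral {k} p∤ = integral (ℤ.+ 1) (suc k) p∤
    (trans (*-comm (1/suc k) (ℕ→ℚ (suc k))) (recip-inverse (suc k)))

  Unit : ℚ → Set
  Unit x = Σ ℚ λ w → Integral w × x * w ≡ 1ℚ

  ℤ-unit : ∀ z → ¬ p ∣ ℤ.∣ z ∣ → Unit (ℤ→ℚ z)
  ℤ-unit (ℤ.+ zero)  p∤ = contradiction (p ∣0) p∤
  ℤ-unit (ℤ.+ suc n) p∤ = 1/suc n , 1/suc-integral p∤ , recip-inverse (suc n)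
  ℤ-unit -[1+ n ]    p∤ = - 1/suc n , neg-integral (1/suc-integral p∤) ,
    trans (neg-* (ℕ→ℚ (suc n)) (1/suc n)) (recip-inverse (suc n))
    where
    neg-* : ∀ x y → - x * - y ≡ x * y
    neg-* = solve-∀ ℚ-ring

  -- If x = n/(d+1) in lowest terms and x = a/b, then nb = a(d+1); coprimality makes d+1 divide b,
  -- and p does not divide b.
  integral⇒p∤↧ : ∀ {x} → Integral x → ¬ p ∣ ↧ₙ x
  integral⇒p∤↧ {x@(mkℚ n d cop)} (integral a b p∤b xb) p∣↧ =
    p∤b (∣-trans p∣↧ (coprime-divisor {suc d} {ℤ.∣ n ∣} {b} (coprime-sym (coprime-recompute cop))
      (divides ℤ.∣ a ∣ crossed)))
    where
    open ≡-Reasoning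
    x*↧ : ℕ→ℚ (suc d) * x ≡ ℤ→ℚ n
    x*↧ = begin
      ℕ→ℚ (suc d) * x                             ≡⟨ cong (ℕ→ℚ (suc d) *_) (↥p/↧p≡p x) ⟨
      ℕ→ℚ (suc d) * (n / suc d)                   ≡⟨ fromℚᵘ-homo-* (mkℚᵘ (ℤ.+ suc d) 0) (mkℚᵘ n d) ⟩
      fromℚᵘ (mkℚᵘ (ℤ.+ suc d) 0 ℚᵘ.* mkℚᵘ n d)   ≡⟨ fromℚᵘ-cong {mkℚᵘ (ℤ.+ suc d) 0 ℚᵘ.* mkℚᵘ n d} {mkℚᵘ n 0} (*≡* cancel) ⟩
      ℤ→ℚ n                                       ∎
      where
      cancel : ℤ.+ suc d ℤ.* n ℤ.* ℤ.+ 1 ≡ n ℤ.* ℤ.+ suc (d ℕ.+ 0)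
      cancel = trans (ℤ.*-identityʳ _) (trans (ℤ.*-comm (ℤ.+ suc d) n)
        (cong (λ e → n ℤ.* (ℤ.+ suc e)) (sym (ℕ.+-identityʳ d))))
    crossedℚ : ℤ→ℚ (n ℤ.* ℤ.+ b) ≡ ℤ→ℚ (a ℤ.* ℤ.+ suc d)
    crossedℚ = begin
      ℤ→ℚ (n ℤ.* ℤ.+ b)               ≡⟨ ℤ→ℚ-homo-* n (ℤ.+ b) ⟩
      ℤ→ℚ n * ℕ→ℚ b                   ≡⟨ cong (_* ℕ→ℚ b) x*↧ ⟨
      ℕ→ℚ (suc d) * x * ℕ→ℚ b         ≡⟨ trans (*-assoc (ℕ→ℚ (suc d)) x (ℕ→ℚ b)) (cong (ℕ→ℚ (suc d) *_) xb) ⟩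
      ℕ→ℚ (suc d) * ℤ→ℚ a             ≡⟨ *-comm (ℕ→ℚ (suc d)) (ℤ→ℚ a) ⟩
      ℤ→ℚ a * ℕ→ℚ (suc d)             ≡⟨ ℤ→ℚ-homo-* a (ℤ.+ suc d) ⟨
      ℤ→ℚ (a ℤ.* ℤ.+ suc d)           ∎
    crossed : ℤ.∣ n ∣ ℕ.* b ≡ ℤ.∣ a ∣ ℕ.* suc d
    crossed = begin
      ℤ.∣ n ∣ ℕ.* b              ≡⟨ ℤ.abs-* n (ℤ.+ b) ⟨
      ℤ.∣ n ℤ.* ℤ.+ b ∣          ≡⟨ cong ℤ.∣_∣ (ℤ→ℚ-injective {n ℤ.* ℤ.+ b} {a ℤ.* ℤ.+ suc d} crossedℚ) ⟩
      ℤ.∣ a ℤ.* ℤ.+ suc d ∣      ≡⟨ ℤ.abs-* a (ℤ.+ suc d) ⟩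
      ℤ.∣ a ∣ ℕ.* suc d          ∎

  sgn-integral : ∀ k → Integral (sgn k)
  sgn-integral zero    = ℕ-integral 1
  sgn-integral (suc k) = neg-integral (sgn-integral k)

  c-integral : ∀ z k → Integral (c (ℤ→ℚ z) k)
  c-integral (ℤ.+ n)  k = subst Integral (sym (c-ℕ n k))
    (*-integral (sgn-integral k) (ℕ-integral ((n C k) ℕ.* ((n ℕ.+ k) C k))))
  c-integral -[1+ n ] k = subst Integral (sym (c-neg n k)) (c-integral (ℤ.+ n) k)

-- Congruences modulo p²

-- Reads a product of consecutive factors from its upper end, so that next to `poch` it places the
-- factor p - r beside the factor r.
falling : ℚ → ℕ → ℚ
falling x zero    = 1ℚ
falling x (suc k) = falling x k * (x - ℕ→ℚ k)

poch-falling : ∀ x k → poch (x + 1ℚ) k ≡ falling (x + ℕ→ℚ k) k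
poch-falling x zero    = refl
poch-falling x (suc k) = begin
  poch (x + 1ℚ) (suc k)
    ≡⟨ poch-sucˡ (x + 1ℚ) k ⟩
  (x + 1ℚ) * poch (x + 1ℚ + 1ℚ) k
    ≡⟨ cong ((x + 1ℚ) *_) (poch-falling (x + 1ℚ) k) ⟩
  (x + 1ℚ) * falling (x + 1ℚ + ℕ→ℚ k) k
    ≡⟨ regroup x (ℕ→ℚ k) (falling (x + 1ℚ + ℕ→ℚ k) k) ⟩
  falling (x + 1ℚ + ℕ→ℚ k) k * (x + 1ℚ + ℕ→ℚ k - ℕ→ℚ k)
    ≡⟨ cong (λ y → falling y (suc k)) (trans (+-assoc x 1ℚ (ℕ→ℚ k)) (cong (x +_) (sym (ℕ→ℚ-suc k)))) ⟩
  falling (x + ℕ→ℚ (suc k)) (suc k) ∎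
  where
  open ≡-Reasoning
  regroup : ∀ x k f → (x + 1ℚ) * f ≡ f * (x + 1ℚ + k - k)
  regroup = solve-∀ ℚ-ring

-- A jump of b indices, with (a+b)!/a! = (1+a)_b cleared from the denominator. It serves for a = pm
-- and b = p, where (1+a)_b is divisible by p.
hyp-+ : ∀ x y a b →
  hyp x y (a ℕ.+ b) * (poch (1ℚ + ℕ→ℚ a) b * poch (1ℚ + ℕ→ℚ a) b) ≡
  hyp x y a * (poch (x + ℕ→ℚ a) b * poch (y + ℕ→ℚ a) b)
hyp-+ x y a zero    = cong (λ k → hyp x y k * (1ℚ * 1ℚ)) (ℕ.+-identityʳ a)
hyp-+ x y a (suc b) = begin
  hyp x y (a ℕ.+ suc b) * (π * (1ℚ + α + β) * (π * (1ℚ + α + β)))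
    ≡⟨ cong (_* (π * (1ℚ + α + β) * (π * (1ℚ + α + β))))
         (trans (cong (hyp x y) (ℕ.+-suc a b)) (trans (hyp-suc x y (a ℕ.+ b))
           (cong (λ s → h * ((x + s) * (y + s)) * (r * r)) (ℕ→ℚ-homo-+ a b)))) ⟩
  h * ((x + (α + β)) * (y + (α + β))) * (r * r) * (π * (1ℚ + α + β) * (π * (1ℚ + α + β)))
    ≡⟨ combine₂ ((x + (α + β)) * (y + (α + β)) * (r * (1ℚ + (α + β)) * (r * (1ℚ + (α + β)))))
         (h′ * (ξ * υ) * ((x + (α + β)) * (y + (α + β))) * (r * (1ℚ + (α + β)) + 1ℚ))
         (hyp-+ x y a b) inverse (rearrange x y α β h h′ r π ξ υ) ⟩
  h′ * (ξ * (x + α + β) * (υ * (y + α + β))) ∎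
  where
  open ≡-Reasoning
  α β h h′ r π ξ υ : ℚ
  α = ℕ→ℚ a
  β = ℕ→ℚ b
  h = hyp x y (a ℕ.+ b)
  h′ = hyp x y a
  r = 1/suc (a ℕ.+ b)
  π = poch (1ℚ + α) b
  ξ = poch (x + α) b
  υ = poch (y + α) b
  inverse : (1ℚ + (α + β)) * r ≡ 1ℚ
  inverse = trans (cong (λ s → (1ℚ + s) * r) (sym (ℕ→ℚ-homo-+ a b))) (1/suc-inverse (a ℕ.+ b))
  rearrange : ∀ x y α β h h′ r π ξ υ →
    h * ((x + (α + β)) * (y + (α + β))) * (r * r) * (π * (1ℚ + α + β) * (π * (1ℚ + α + β)))
      - h′ * (ξ * (x + α + β) * (υ * (y + α + β)))
    ≡ (x + (α + β)) * (y + (α + β)) * (r * (1ℚ + (α + β)) * (r * (1ℚ + (α + β)))) * (h * (π * π) - h′ * (ξ * υ))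
      + h′ * (ξ * υ) * ((x + (α + β)) * (y + (α + β))) * (r * (1ℚ + (α + β)) + 1ℚ) * ((1ℚ + (α + β)) * r - 1ℚ)
  rearrange = solve-∀ ℚ-ring

-- Up to sign c(z,k) is Γ(z+k+1) / (Γ(z-k+1) k!²), so raising z by one multiplies it by
-- (z+1+k)/(z+1-k).
c-shift : ∀ z k → (z + 1ℚ - ℕ→ℚ k) * c (z + 1ℚ) k ≡ (z + 1ℚ + ℕ→ℚ k) * c z k
c-shift z zero    = base z
  where
  base : ∀ z → (z + 1ℚ - 0ℚ) * 1ℚ ≡ (z + 1ℚ + 0ℚ) * 1ℚ
  base = solve-∀ ℚ-ring
c-shift z (suc k) = begin
  (z + 1ℚ - ℕ→ℚ (suc k)) * c (z + 1ℚ) (suc k)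
    ≡⟨ cong₂ (λ s t → (z + 1ℚ - s) * t) (ℕ→ℚ-suc k) (hyp-suc (- (z + 1ℚ)) (z + 1ℚ + 1ℚ) k) ⟩
  (z + 1ℚ - (1ℚ + κ)) * (c (z + 1ℚ) k * ((- (z + 1ℚ) + κ) * (z + 1ℚ + 1ℚ + κ)) * (r * r))
    ≡⟨ combine₁ (- ((z - κ) * (z + 1ℚ + 1ℚ + κ) * (r * r))) (c-shift z k) (rearrange z κ r (c (z + 1ℚ) k) (c z k)) ⟩
  (z + 1ℚ + (1ℚ + κ)) * (c z k * ((- z + κ) * (z + 1ℚ + κ)) * (r * r))
    ≡⟨ cong₂ (λ s t → (z + 1ℚ + s) * t) (ℕ→ℚ-suc k) (hyp-suc (- z) (z + 1ℚ) k) ⟨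
  (z + 1ℚ + ℕ→ℚ (suc k)) * c z (suc k) ∎
  where
  open ≡-Reasoning
  κ r : ℚ
  κ = ℕ→ℚ k
  r = 1/suc k
  rearrange : ∀ z κ r c′ c →
    (z + 1ℚ - (1ℚ + κ)) * (c′ * ((- (z + 1ℚ) + κ) * (z + 1ℚ + 1ℚ + κ)) * (r * r))
      - (z + 1ℚ + (1ℚ + κ)) * (c * ((- z + κ) * (z + 1ℚ + κ)) * (r * r))
    ≡ - ((z - κ) * (z + 1ℚ + 1ℚ + κ) * (r * r)) * ((z + 1ℚ - κ) * c′ - (z + 1ℚ + κ) * c)
  rearrange = solve-∀ ℚ-ring

-- p is a variable equal to suc q, rather than suc q itself, to keep p * suc m from unfolding.
module Supercongruence (p q : ℕ) (p≡1+q : p ≡ suc q) (p-prime : Prime p) where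

  open PAdic p p-prime

  P : ℚ
  P = ℕ→ℚ p

  P≡1+q : P ≡ 1ℚ + ℕ→ℚ q
  P≡1+q = trans (cong ℕ→ℚ p≡1+q) (ℕ→ℚ-suc q)

  P-integral : Integral P
  P-integral = ℕ-integral p

  1-integral : Integral 1ℚ
  1-integral = ℕ-integral 1

  record DivBy (a x : ℚ) : Set where
    constructor divBy
    field
      quotient   : ℚ
      q-integral : Integral quotient
      x≡a*q      : x ≡ a * quotient

  divBy-resp : ∀ {a x y} → x ≡ y → DivBy a x → DivBy a y
  divBy-resp refl h = h

  divBy-*ʳ : ∀ {a x y} → DivBy a x → Integral y → DivBy a (x * y)
  divBy-*ʳ {a} {x} {y} (divBy r r-int x≡ar) y-int =
    divBy (r * y) (*-integral r-int y-int) (trans (cong (_* y) x≡ar) (*-assoc a r y))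

  divBy-+ : ∀ {a x y} → DivBy a x → DivBy a y → DivBy a (x + y)
  divBy-+ {a} (divBy r r-int x≡ar) (divBy s s-int y≡as) =
    divBy (r + s) (+-integral r-int s-int) (trans (cong₂ _+_ x≡ar y≡as) (sym (*-distribˡ-+ a r s)))

  infix 4 _≈_
  record _≈_ (x y : ℚ) : Set where
    constructor ≈-divBy
    field
      p²∣x-y : DivBy (P * P) (x - y)

  ≡⇒≈ : ∀ {x y} → x ≡ y → x ≈ y
  ≡⇒≈ {x} refl = ≈-divBy (divBy 0ℚ (ℕ-integral 0) (trans (+-inverseʳ x) (sym (*-zeroʳ (P * P)))))

  ≈-trans : ∀ {x y z} → x ≈ y → y ≈ z → x ≈ z
  ≈-trans {x} {y} {z} (≈-divBy x≈y) (≈-divBy y≈z) = ≈-divBy (divBy-resp (telescope x y z) (divBy-+ x≈y y≈z))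
    where
    telescope : ∀ x y z → x - y + (y - z) ≡ x - z
    telescope = solve-∀ ℚ-ring

  ≈-sym : ∀ {x y} → x ≈ y → y ≈ x
  ≈-sym {x} {y} (≈-divBy x≈y) = ≈-divBy (divBy-resp (flip x y) (divBy-*ʳ x≈y (ℤ-integral ℤ.-1ℤ)))
    where
    flip : ∀ x y → (x - y) * - 1ℚ ≡ y - x
    flip = solve-∀ ℚ-ring

  +-cong-≈ : ∀ {x x′ y y′} → x ≈ x′ → y ≈ y′ → x + y ≈ x′ + y′
  +-cong-≈ {x} {x′} {y} {y′} (≈-divBy x≈x′) (≈-divBy y≈y′) =
    ≈-divBy (divBy-resp (regroup x x′ y y′) (divBy-+ x≈x′ y≈y′))
    where
    regroup : ∀ x x′ y y′ → x - x′ + (y - y′) ≡ x + y - (x′ + y′)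
    regroup = solve-∀ ℚ-ring

  -- The relation constrains a difference only, so the cofactors in (x-x′) y + (y-y′) x′ must be
  -- integral separately.
  *-cong-≈ : ∀ {x x′ y y′} → Integral y → Integral x′ → x ≈ x′ → y ≈ y′ → x * y ≈ x′ * y′
  *-cong-≈ {x} {x′} {y} {y′} y-int x′-int (≈-divBy x≈x′) (≈-divBy y≈y′) =
    ≈-divBy (divBy-resp (regroup x x′ y y′) (divBy-+ (divBy-*ʳ x≈x′ y-int) (divBy-*ʳ y≈y′ x′-int)))
    where
    regroup : ∀ x x′ y y′ → (x - x′) * y + (y - y′) * x′ ≡ x * y - x′ * y′
    regroup = solve-∀ ℚ-ring

  sum-cong-≈ : ∀ K {f g} → (∀ k → k ≤ K → f k ≈ g k) → sumTo K f ≈ sumTo K g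
  sum-cong-≈ zero    h = h 0 z≤n
  sum-cong-≈ (suc K) h = +-cong-≈ (sum-cong-≈ K (λ k k≤K → h k (ℕ.m≤n⇒m≤1+n k≤K))) (h (suc K) ℕ.≤-refl)

  <p⇒p∤ : ∀ {k} → suc k < p → ¬ p ∣ suc k
  <p⇒p∤ = >⇒∤

  1/suc-integral-< : ∀ {k} → suc k < p → Integral (1/suc k)
  1/suc-integral-< 1+k<p = 1/suc-integral (<p⇒p∤ 1+k<p)

  H-integral : ∀ {k} → k < p → Integral (H k)
  H-integral {zero}  _     = ℕ-integral 0
  H-integral {suc k} 1+k<p = +-integral (H-integral (ℕ.<⇒≤ 1+k<p)) (1/suc-integral-< 1+k<p)

  -- The integer 1 + r + pa is congruent to 1 + r modulo p, and 0 < 1 + r < p.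
  unit-shift : ∀ {r} a → suc r < p → Unit (1ℚ + ℕ→ℚ r + P * ℤ→ℚ a)
  unit-shift {r} a 1+r<p = subst Unit
    (trans (ℤ→ℚ-homo-+ (ℤ.+ suc r) (ℤ.+ p ℤ.* a)) (cong₂ _+_ (ℕ→ℚ-suc r) (ℤ→ℚ-homo-* (ℤ.+ p) a)))
    (ℤ-unit (ℤ.+ suc r ℤ.+ ℤ.+ p ℤ.* a) λ p∣ → <p⇒p∤ 1+r<p
      (ℤ∣.∣⇒∣ᵤ {ℤ.+ p} {ℤ.+ suc r} (ℤ∣.∣m+n∣n⇒∣m {ℤ.+ p} {ℤ.+ suc r} {ℤ.+ p ℤ.* a}
        (ℤ∣.∣ᵤ⇒∣ p∣) (ℤ∣.∣m⇒∣m*n a ℤ∣.∣-refl))))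

  poch-integral : ∀ {x} → Integral x → ∀ k → Integral (poch x k)
  poch-integral x-int zero    = 1-integral
  poch-integral x-int (suc k) = *-integral (poch-integral x-int k) (+-integral x-int (ℕ-integral k))

  falling-integral : ∀ {x} → Integral x → ∀ k → Integral (falling x k)
  falling-integral x-int zero    = 1-integral
  falling-integral x-int (suc k) = *-integral (falling-integral x-int k) (-‿integral x-int (ℕ-integral k))

  poch-unit : ∀ x k → (∀ i → i < k → Unit (x + ℕ→ℚ i)) → Unit (poch x k)
  poch-unit x zero    _ = 1ℚ , 1-integral , refl
  poch-unit x (suc k) h with poch-unit x k (λ i i<k → h i (ℕ.m≤n⇒m≤1+n i<k)) | h k ℕ.≤-refl
  ... | w , w-int , xw | v , v-int , yv = w * v , *-integral w-int v-int ,
    trans (regroup (poch x k) (x + ℕ→ℚ k) w v) (cong₂ _*_ xw yv)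
    where
    regroup : ∀ a b w v → a * b * (w * v) ≡ a * w * (b * v)
    regroup = solve-∀ ℚ-ring

  -- Blocks: the product of pt + r over 0 < r < p

  block : ℚ → ℚ
  block t = poch (P * t + 1ℚ) q

  Pt+1-integral : ∀ {t} → Integral t → Integral (P * t + 1ℚ)
  Pt+1-integral t-int = +-integral (*-integral P-integral t-int) 1-integral

  block-integral : ∀ {t} → Integral t → Integral (block t)
  block-integral t-int = poch-integral (Pt+1-integral t-int) q

  -- (pt + r)(pt + p - r) ≡ r(p - r) modulo p².
  paired-≈ : ∀ {t} → Integral t → ∀ k →
    poch (P * t + 1ℚ) k * falling (P * t + ℕ→ℚ q) k ≈ poch 1ℚ k * falling (ℕ→ℚ q) k
  paired-≈ t-int zero    = ≡⇒≈ refl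
  paired-≈ {t} t-int (suc k) =
    subst₂ _≈_ (regroup a (P * t + 1ℚ + κ) b (P * t + Q - κ)) (regroup a′ (1ℚ + κ) b′ (Q - κ)) (*-cong-≈
      (*-integral (+-integral (Pt+1-integral t-int) (ℕ-integral k))
                 (-‿integral (+-integral (*-integral P-integral t-int) (ℕ-integral q)) (ℕ-integral k)))
      (*-integral (poch-integral 1-integral k) (falling-integral (ℕ-integral q) k))
      (paired-≈ t-int k)
      -- With r = k + 1 the difference of the two products is exactly p² t (t+1).
      (≈-divBy (divBy (t * (t + 1ℚ)) (*-integral t-int (+-integral t-int 1-integral))
        (combine₁ (- (P * t)) P≡1+q (rearrange P t κ Q)))))
    where
    a b a′ b′ κ Q : ℚ
    a = poch (P * t + 1ℚ) k
    b = falling (P * t + ℕ→ℚ q) k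
    a′ = poch 1ℚ k
    b′ = falling (ℕ→ℚ q) k
    κ = ℕ→ℚ k
    Q = ℕ→ℚ q
    regroup : ∀ a x b y → a * b * (x * y) ≡ a * x * (b * y)
    regroup = solve-∀ ℚ-ring
    rearrange : ∀ P t κ Q → (P * t + 1ℚ + κ) * (P * t + Q - κ) - (1ℚ + κ) * (Q - κ) - P * P * (t * (t + 1ℚ)) ≡
                            - (P * t) * (P - (1ℚ + Q))
    rearrange = solve-∀ ℚ-ring

  -- One copy of the block is read upwards and the other downwards; the paired product no longer
  -- involves t modulo p².
  block²-≈ : ∀ {s t} → Integral s → Integral t → block s * block s ≈ block t * block t
  block²-≈ s-int t-int = ≈-trans (to-pairs s-int) (≈-sym (to-pairs t-int))
    where
    to-pairs : ∀ {t} → Integral t → block t * block t ≈ poch 1ℚ q * falling (ℕ→ℚ q) q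
    to-pairs {t} t-int = subst (λ x → block t * x ≈ poch 1ℚ q * falling (ℕ→ℚ q) q)
      (sym (poch-falling (P * t) q)) (paired-≈ t-int q)

  block-unit : ∀ m → Unit (block (ℕ→ℚ m))
  block-unit m = poch-unit (P * ℕ→ℚ m + 1ℚ) q λ i i<q →
    subst Unit (rearrange (ℕ→ℚ i) (P * ℕ→ℚ m)) (unit-shift {i} (ℤ.+ m) (subst (suc i <_) (sym p≡1+q) (s≤s i<q)))
    where
    rearrange : ∀ i x → 1ℚ + i + x ≡ x + 1ℚ + i
    rearrange = solve-∀ ℚ-ring

  -- To first order h is the logarithm of v divided by p, so multiplying the v adds the h.
  record Square≈ (v h : ℚ) : Set where
    constructor square≈
    field
      v-integral : Integral v
      h-integral : Integral h
      v²≈        : v * v ≈ 1ℚ + (P + P) * h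

  square≈-* : ∀ {v h v′ h′} → Square≈ v h → Square≈ v′ h′ → Square≈ (v * v′) (h + h′)
  square≈-* {v} {h} {v′} {h′} (square≈ v-int h-int (≈-divBy (divBy r r-int vr)))
    (square≈ v′-int h′-int (≈-divBy (divBy s s-int vs))) =
    square≈ (*-integral v-int v′-int) (+-integral h-int h′-int)
      -- The summand 4hh′ comes from (1+2ph)(1+2ph′) = 1 + 2p(h+h′) + 4p²hh′.
      (≈-divBy (divBy (r * (v′ * v′) + (1ℚ + (P + P) * h) * s + (1ℚ + 1ℚ + 1ℚ + 1ℚ) * (h * h′))
        (+-integral (+-integral (*-integral r-int (*-integral v′-int v′-int))
          (*-integral (+-integral 1-integral (*-integral (+-integral P-integral P-integral) h-int)) s-int))
          (*-integral (ℕ-integral 4) (*-integral h-int h′-int)))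
        (combine₂ (v′ * v′) (1ℚ + (P + P) * h) vr vs (rearrange P v v′ h h′ r s))))
    where
    rearrange : ∀ P v v′ h h′ r s →
      v * v′ * (v * v′) - (1ℚ + (P + P) * (h + h′))
        - P * P * (r * (v′ * v′) + (1ℚ + (P + P) * h) * s + (1ℚ + 1ℚ + 1ℚ + 1ℚ) * (h * h′))
      ≡ v′ * v′ * (v * v - (1ℚ + (P + P) * h) - P * P * r)
        + (1ℚ + (P + P) * h) * (v′ * v′ - (1ℚ + (P + P) * h′) - P * P * s)
    rearrange = solve-∀ ℚ-ring

  square≈-quotient : ∀ {R r a} → R * r ≡ 1ℚ → Integral R → Integral r → Integral a →
                     Square≈ ((R + P * a) * r) (a * r)
  square≈-quotient {R} {r} {a} Rr R-int r-int a-int = square≈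
    (*-integral (+-integral R-int (*-integral P-integral a-int)) r-int) (*-integral a-int r-int)
    (≈-divBy (divBy (a * r * (a * r)) (*-integral (*-integral a-int r-int) (*-integral a-int r-int))
      (combine₁ (R * r + 1ℚ + (P + P) * a * r) Rr (rearrange P R r a))))
    where
    rearrange : ∀ P R r a →
      (R + P * a) * r * ((R + P * a) * r) - (1ℚ + (P + P) * (a * r)) - P * P * (a * r * (a * r)) ≡
      (R * r + 1ℚ + (P + P) * a * r) * (R * r - 1ℚ)
    rearrange = solve-∀ ℚ-ring

  square≈-quotient⁻¹ : ∀ {R r b w} → R * r ≡ 1ℚ → (R + P * b) * w ≡ 1ℚ →
                       Integral R → Integral r → Integral b → Integral w →
                       Square≈ (R * w) (- (b * r))
  square≈-quotient⁻¹ {R} {r} {b} {w} Rr Rw R-int r-int b-int w-int = square≈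
    (*-integral R-int w-int) (neg-integral (*-integral b-int r-int))
    -- Here Rw = 1 - pbw and w = r - pbrw. Substituting the latter into the linear term of (1-pbw)²
    -- gives 1 - 2pbr + p²b²(2rw + w²).
    (≈-divBy (divBy (b * b * (r * w + r * w + w * w))
      (*-integral (*-integral b-int b-int)
        (+-integral (+-integral (*-integral r-int w-int) (*-integral r-int w-int)) (*-integral w-int w-int)))
      (combine₂ ((P * b + P * b) * w) (1ℚ - P * b * w + R * w - (P * b + P * b) * r) Rr Rw (rearrange P R r b w))))
    where
    rearrange : ∀ P R r b w →
      R * w * (R * w) - (1ℚ + (P + P) * - (b * r)) - P * P * (b * b * (r * w + r * w + w * w)) ≡
      (P * b + P * b) * w * (R * r - 1ℚ) + (1ℚ - P * b * w + R * w - (P * b + P * b) * r) * ((R + P * b) * w - 1ℚ)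
    rearrange = solve-∀ ℚ-ring

  -- A multiplier instead of the quotient x/y, since y may be zero: c(n,m) vanishes for m > |n|.
  record Lift (x y h : ℚ) : Set where
    constructor lift
    field
      factor  : ℚ
      x≡      : x ≡ y * factor
      factor≈ : Square≈ factor h

  square≈-resp : ∀ {v h h′} → h ≡ h′ → Square≈ v h → Square≈ v h′
  square≈-resp refl s = s

  ℕ→ℚ-p* : ∀ m → ℕ→ℚ (p ℕ.* m) ≡ P * ℕ→ℚ m
  ℕ→ℚ-p* m = ℕ→ℚ-homo-* p m

  -- After squaring, two squared blocks stand over the fourth power of `block m`. All squared blocks
  -- agree modulo p², hence exponent 0.
  square≈-blocks : ∀ {a b m w} → Integral a → Integral b → Integral m → Integral w → block m * w ≡ 1ℚ →
                   Square≈ (w * w * (block a * block b)) 0ℚ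
  square≈-blocks {a} {b} {m} {w} a-int b-int m-int w-int Bw = square≈
    (*-integral w²-int (*-integral (block-integral a-int) (block-integral b-int))) (ℕ-integral 0)
    (≈-trans (≡⇒≈ (regroup w (block a) (block b)))
      (≈-trans (*-cong-≈ (*-integral B²-int (*-integral (block-integral b-int) (block-integral b-int)))
          (*-integral w²-int w²-int) (≡⇒≈ refl)
          (*-cong-≈ (*-integral (block-integral b-int) (block-integral b-int)) B²-int′
            (block²-≈ a-int m-int) (block²-≈ b-int m-int)))
        (≡⇒≈ (combine₁ ((block m * w + 1ℚ) * (block m * w * (block m * w) + 1ℚ)) Bw (rearrange P w (block m))))))
    where
    w²-int : Integral (w * w)
    w²-int = *-integral w-int w-int
    B²-int : Integral (block a * block a)
    B²-int = *-integral (block-integral a-int) (block-integral a-int)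
    B²-int′ : Integral (block m * block m)
    B²-int′ = *-integral (block-integral m-int) (block-integral m-int)
    regroup : ∀ w x y → w * w * (x * y) * (w * w * (x * y)) ≡ w * w * (w * w) * (x * x * (y * y))
    regroup = solve-∀ ℚ-ring
    rearrange : ∀ P w B → w * w * (w * w) * (B * B * (B * B)) - (1ℚ + (P + P) * 0ℚ) ≡
      (B * w + 1ℚ) * (B * w * (B * w) + 1ℚ) * (B * w - 1ℚ)
    rearrange = solve-∀ ℚ-ring

  -- Lifting along the base-p digits

  lift-* : ∀ {x x′ y h u k} → Lift x y h → x′ ≡ x * u → Square≈ u k → Lift x′ y (h + k)
  lift-* {y = y} {u = u} (lift v x≡ v≈) x′≡ u≈ =
    lift (v * u) (trans x′≡ (trans (cong (_* u) x≡) (*-assoc y v u))) (square≈-* v≈ u≈)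

  lift-resp : ∀ {x y h h′} → h ≡ h′ → Lift x y h → Lift x y h′
  lift-resp refl l = l

  -- Not p-integral: it enters only an exact identity in ℚ, where each occurrence meets a factor P.
  1/P : ℚ
  1/P = 1/suc q

  P*1/P : P * 1/P ≡ 1ℚ
  P*1/P = trans (cong (_* 1/P) P≡1+q) (1/suc-inverse q)

  -- Each Pochhammer symbol gains p consecutive factors, exactly one of them a visible multiple of
  -- p: p(m+1), p(m-n) and p(n+m+1). Once the p cancel, these reproduce the step from c(n,m) to
  -- c(n,m+1); the remaining factors form blocks.
  lift-block : ∀ n m → Lift (c (P * ℤ→ℚ n) (p ℕ.* m)) (c (ℤ→ℚ n) m) 0ℚ → Unit (block (ℕ→ℚ m)) →
               Lift (c (P * ℤ→ℚ n) (p ℕ.* suc m)) (c (ℤ→ℚ n) (suc m)) 0ℚ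
  lift-block n m (lift v G≡gv v≈) (w , w-int , Bw) = lift (v * (w * w * (B₁ * B₂))) G′≡
      (square≈-resp (+-identityˡ 0ℚ) (square≈-* v≈ (square≈-blocks
        (-‿integral (ℕ-integral m) (ℤ-integral n)) (+-integral (ℤ-integral n) (ℕ-integral m)) (ℕ-integral m) w-int Bw)))
    where
    open ≡-Reasoning
    N M g g′ G G′ B B₁ B₂ r : ℚ
    N = ℤ→ℚ n
    M = ℕ→ℚ m
    g = c N m
    g′ = c N (suc m)
    G = c (P * N) (p ℕ.* m)
    G′ = c (P * N) (p ℕ.* suc m)
    B = block M
    B₁ = block (M - N)
    B₂ = block (N + M)
    r = 1/suc m
    X₀ X₁ X₂ i : ℚ
    X₀ = B * (P * (1ℚ + M))
    X₁ = P * (M - N) * B₁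
    X₂ = B₂ * (P * (N + M + 1ℚ))
    i = w * 1/P * r
    poch₀ : poch (1ℚ + ℕ→ℚ (p ℕ.* m)) p ≡ X₀
    poch₀ = trans (cong₂ poch (trans (cong (1ℚ +_) (ℕ→ℚ-p* m)) (+-comm 1ℚ (P * M))) p≡1+q)
      (cong (B *_) (combine₁ (- 1ℚ) P≡1+q (rearrange P M (ℕ→ℚ q))))
      where
      rearrange : ∀ P M Q → P * M + 1ℚ + Q - P * (1ℚ + M) ≡ - 1ℚ * (P - (1ℚ + Q))
      rearrange = solve-∀ ℚ-ring
    poch₁ : poch (- (P * N) + ℕ→ℚ (p ℕ.* m)) p ≡ X₁
    poch₁ = trans (cong₂ poch (trans (cong (- (P * N) +_) (ℕ→ℚ-p* m)) (factor P N M)) p≡1+q)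
      (poch-sucˡ (P * (M - N)) q)
      where
      factor : ∀ P N M → - (P * N) + P * M ≡ P * (M - N)
      factor = solve-∀ ℚ-ring
    poch₂ : poch (P * N + 1ℚ + ℕ→ℚ (p ℕ.* m)) p ≡ X₂
    poch₂ = trans (cong₂ poch (trans (cong (P * N + 1ℚ +_) (ℕ→ℚ-p* m)) (factor P N M)) p≡1+q)
      (cong (B₂ *_) (combine₁ (- 1ℚ) P≡1+q (rearrange P N M (ℕ→ℚ q))))
      where
      factor : ∀ P N M → P * N + 1ℚ + P * M ≡ P * (N + M) + 1ℚ
      factor = solve-∀ ℚ-ring
      rearrange : ∀ P N M Q → P * (N + M) + 1ℚ + Q - P * (N + M + 1ℚ) ≡ - 1ℚ * (P - (1ℚ + Q))
      rearrange = solve-∀ ℚ-ring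
    block-step : G′ * (X₀ * X₀) ≡ G * (X₁ * X₂)
    block-step = trans
      (cong₂ (λ k s → c (P * N) k * (s * s)) (trans (ℕ.*-suc p m) (ℕ.+-comm p (p ℕ.* m))) (sym poch₀))
      (trans (hyp-+ (- (P * N)) (P * N + 1ℚ) (p ℕ.* m) p) (cong₂ (λ s t → G * (s * t)) poch₁ poch₂))
    inverse : X₀ * i ≡ 1ℚ
    inverse = trans (regroup B P (1ℚ + M) w 1/P r) (cong₂ _*_ (cong₂ _*_ Bw P*1/P) (1/suc-inverse m))
      where
      regroup : ∀ B P M w π r → B * (P * M) * (w * π * r) ≡ B * w * (P * π) * (M * r)
      regroup = solve-∀ ℚ-ring
    G′≡ : G′ ≡ g′ * (v * (w * w * (B₁ * B₂)))
    G′≡ = begin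
      G′
        ≡⟨ combine₂ (- (G′ * (X₀ * i + 1ℚ))) (i * i) inverse block-step (solve-for G′ X₀ i (G * (X₁ * X₂))) ⟩
      G * (X₁ * X₂) * (i * i)
        ≡⟨ cong (λ s → s * (X₁ * X₂) * (i * i)) G≡gv ⟩
      g * v * (X₁ * X₂) * (i * i)
        ≡⟨ combine₁ (g * v * ((- N + M) * (N + 1ℚ + M)) * (r * r) * (w * w) * (B₁ * B₂) * (P * 1/P + 1ℚ))
             P*1/P (rearrange g v N M r w P 1/P B₁ B₂) ⟩
      g * ((- N + M) * (N + 1ℚ + M)) * (r * r) * (v * (w * w * (B₁ * B₂)))
        ≡⟨ cong (_* (v * (w * w * (B₁ * B₂)))) (sym (hyp-suc (- N) (N + 1ℚ) m)) ⟩
      g′ * (v * (w * w * (B₁ * B₂))) ∎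
      where
      solve-for : ∀ G X i T → G - T * (i * i) ≡ - (G * (X * i + 1ℚ)) * (X * i - 1ℚ) + i * i * (G * (X * X) - T)
      solve-for = solve-∀ ℚ-ring
      rearrange : ∀ g v N M r w P π B₁ B₂ →
        g * v * (P * (M - N) * B₁ * (B₂ * (P * (N + M + 1ℚ)))) * (w * π * r * (w * π * r))
          - g * ((- N + M) * (N + 1ℚ + M)) * (r * r) * (v * (w * w * (B₁ * B₂)))
        ≡ g * v * ((- N + M) * (N + 1ℚ + M)) * (r * r) * (w * w) * (B₁ * B₂) * (P * π + 1ℚ) * (P * π - 1ℚ)
      rearrange = solve-∀ ℚ-ring

  lift-blocks : ∀ n m → Lift (c (P * ℤ→ℚ n) (p ℕ.* m)) (c (ℤ→ℚ n) m) 0ℚ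
  lift-blocks n zero = lift 1ℚ (cong (c (P * ℤ→ℚ n)) (ℕ.*-zeroʳ p))
    (square≈ 1-integral (ℕ-integral 0) (≡⇒≈ (base P)))
    where
    base : ∀ P → 1ℚ * 1ℚ ≡ 1ℚ + (P + P) * 0ℚ
    base = solve-∀ ℚ-ring
  lift-blocks n (suc m) = lift-block n m (lift-blocks n m) (block-unit m)

  -- With R = d+1, raising z multiplies c by (R+p(n+m))/(R+p(n-m)). The exponent grows by (n+m)/R -
  -- (n-m)/R = 2m/R.
  lift-d-suc : ∀ n m d → suc d < p →
    Lift (c (ℕ→ℚ d + P * ℤ→ℚ n) (p ℕ.* m)) (c (ℤ→ℚ n) m) ((ℕ→ℚ m + ℕ→ℚ m) * H d) →
    Unit (1ℚ + ℕ→ℚ d + P * ℤ→ℚ (n ℤ.- ℤ.+ m)) →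
    Lift (c (ℕ→ℚ (suc d) + P * ℤ→ℚ n) (p ℕ.* m)) (c (ℤ→ℚ n) m) ((ℕ→ℚ m + ℕ→ℚ m) * H (suc d))
  lift-d-suc n m d 1+d<p G-lift (w , w-int , Rw) = lift-resp (collect N M r (H d))
      (lift-* G-lift G′≡ (square≈-*
        (square≈-quotient (1/suc-inverse d) R-int r-int (+-integral (ℤ-integral n) (ℕ-integral m)))
        (square≈-quotient⁻¹ (1/suc-inverse d) Rw′ R-int r-int (-‿integral (ℤ-integral n) (ℕ-integral m)) w-int)))
    where
    N M R r z G G′ : ℚ
    N = ℤ→ℚ n
    M = ℕ→ℚ m
    R = 1ℚ + ℕ→ℚ d
    r = 1/suc d
    z = ℕ→ℚ d + P * N
    G = c z (p ℕ.* m)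
    G′ = c (ℕ→ℚ (suc d) + P * N) (p ℕ.* m)
    R-int : Integral R
    R-int = +-integral 1-integral (ℕ-integral d)
    r-int : Integral r
    r-int = 1/suc-integral-< 1+d<p
    Rw′ : (R + P * (N - M)) * w ≡ 1ℚ
    Rw′ = trans (cong (λ s → (R + P * s) * w)
      (sym (trans (ℤ→ℚ-homo-+ n (ℤ.- ℤ.+ m)) (cong (N +_) (ℤ→ℚ-homo‿- (ℤ.+ m)))))) Rw
    z+1 : z + 1ℚ ≡ ℕ→ℚ (suc d) + P * N
    z+1 = trans (regroup (ℕ→ℚ d) (P * N)) (cong (_+ P * N) (sym (ℕ→ℚ-suc d)))
      where
      regroup : ∀ d x → d + x + 1ℚ ≡ 1ℚ + d + x
      regroup = solve-∀ ℚ-ring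
    shifted : (z + 1ℚ - P * M) * G′ ≡ (z + 1ℚ + P * M) * G
    shifted = subst₂ (λ s t → (z + 1ℚ - s) * c t (p ℕ.* m) ≡ (z + 1ℚ + s) * G) (ℕ→ℚ-p* m) z+1 (c-shift z (p ℕ.* m))
    G′≡ : G′ ≡ G * ((R + P * (N + M)) * r * (R * w))
    G′≡ = combine₃ (- G′) w (- (G * (R + P * (N + M)) * w)) Rw′ shifted (1/suc-inverse d)
      (rearrange P N M (ℕ→ℚ d) r w G G′)
      where
      rearrange : ∀ P N M d r w G G′ →
        G′ - G * ((1ℚ + d + P * (N + M)) * r * ((1ℚ + d) * w)) ≡
        - G′ * ((1ℚ + d + P * (N - M)) * w - 1ℚ)
          + w * ((d + P * N + 1ℚ - P * M) * G′ - (d + P * N + 1ℚ + P * M) * G)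
          + - (G * (1ℚ + d + P * (N + M)) * w) * ((1ℚ + d) * r - 1ℚ)
      rearrange = solve-∀ ℚ-ring
    collect : ∀ N M r h → (M + M) * h + ((N + M) * r + - ((N - M) * r)) ≡ (M + M) * (h + r)
    collect = solve-∀ ℚ-ring

  lift-d : ∀ n m d → d < p → Lift (c (ℕ→ℚ d + P * ℤ→ℚ n) (p ℕ.* m)) (c (ℤ→ℚ n) m) ((ℕ→ℚ m + ℕ→ℚ m) * H d)
  lift-d n m zero _ = subst₂ (λ z h → Lift (c z (p ℕ.* m)) (c (ℤ→ℚ n) m) h)
    (sym (+-identityˡ (P * ℤ→ℚ n))) (sym (*-zeroʳ (ℕ→ℚ m + ℕ→ℚ m))) (lift-blocks n m)
  lift-d n m (suc d) 1+d<p =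
    lift-d-suc n m d 1+d<p (lift-d n m d (ℕ.<⇒≤ 1+d<p)) (unit-shift {d} (n ℤ.- ℤ.+ m) 1+d<p)

  -- Grouped by n+m and n-m, as the linear factors of c produce it; expanding gives the n-part and
  -- m-part.
  exponent : ℚ → ℚ → ℕ → ℕ → ℚ
  exponent N M d j = (N + M) * H (d ℕ.+ j) - (N - M) * H (d ℕ.∸ j) - (M + M) * H j

  lift-d0 : ∀ n m d → Lift (c (ℕ→ℚ d + P * ℤ→ℚ n) (p ℕ.* m)) (c (ℤ→ℚ n) m) ((ℕ→ℚ m + ℕ→ℚ m) * H d) →
    Lift (c (ℕ→ℚ d + P * ℤ→ℚ n) (p ℕ.* m ℕ.+ 0)) (c (ℤ→ℚ n) m * c (ℕ→ℚ d) 0) (exponent (ℤ→ℚ n) (ℕ→ℚ m) d 0)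
  lift-d0 n m d (lift v x≡ v≈) = lift v
    (trans (cong (c (ℕ→ℚ d + P * ℤ→ℚ n)) (ℕ.+-identityʳ (p ℕ.* m)))
      (trans x≡ (cong (_* v) (sym (*-identityʳ (c (ℤ→ℚ n) m))))))
    (square≈-resp (trans (expand (ℤ→ℚ n) (ℕ→ℚ m) (H d))
      (cong (λ k → (ℤ→ℚ n + ℕ→ℚ m) * H k - (ℤ→ℚ n - ℕ→ℚ m) * H d - (ℕ→ℚ m + ℕ→ℚ m) * 0ℚ) (sym (ℕ.+-identityʳ d)))) v≈)
    where
    expand : ∀ N M h → (M + M) * h ≡ (N + M) * h - (N - M) * h - (M + M) * 0ℚ
    expand = solve-∀ ℚ-ring
  ℕ→ℚ-p*+ : ∀ m j → ℕ→ℚ (p ℕ.* m ℕ.+ j) ≡ P * ℕ→ℚ m + ℕ→ℚ j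
  ℕ→ℚ-p*+ m j = trans (ℕ→ℚ-homo-+ (p ℕ.* m) j) (cong (_+ ℕ→ℚ j) (ℕ→ℚ-p* m))

  -- The last base-p digit of pm+j+1 is j+1, which is not 0.
  ρ-integral : ∀ m {j} → suc j < p → Integral (1/suc (p ℕ.* m ℕ.+ j))
  ρ-integral m {j} 1+j<p = 1/suc-integral λ p∣ → <p⇒p∤ 1+j<p
    (∣m+n∣m⇒∣n (subst (p ∣_) (sym (ℕ.+-suc (p ℕ.* m) j)) p∣) (m∣m*n m))

  -- The new factors are -(d-j+p(n-m)) and d+j+1+p(n+m) over (pm+j+1)², to be compared with -(d-j)
  -- and d+j+1 over (j+1)². Without a carry d-j, d+j+1 and j+1 all lie strictly between 0 and p, so
  -- each ratio has a first-order expansion.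
  lift-dj-suc : ∀ n m d j → suc j ≤ d → d ℕ.+ suc j < p →
    Lift (c (ℕ→ℚ d + P * ℤ→ℚ n) (p ℕ.* m ℕ.+ j)) (c (ℤ→ℚ n) m * c (ℕ→ℚ d) j) (exponent (ℤ→ℚ n) (ℕ→ℚ m) d j) →
    Lift (c (ℕ→ℚ d + P * ℤ→ℚ n) (p ℕ.* m ℕ.+ suc j)) (c (ℤ→ℚ n) m * c (ℕ→ℚ d) (suc j))
      (exponent (ℤ→ℚ n) (ℕ→ℚ m) d (suc j))
  lift-dj-suc n m d j 1+j≤d d+1+j<p (lift v G≡ v≈) = lift (v * u) G′≡ (square≈-resp h≡ (square≈-* v≈
      (square≈-* (square≈-quotient (1/suc-inverse e) (suc-integral e) s-int (-‿integral N-int M-int))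
        (square≈-* (square≈-quotient (1/suc-inverse (d ℕ.+ j)) (suc-integral (d ℕ.+ j)) t-int (+-integral N-int M-int))
          (square≈-* near near)))))
    where
    open ≡-Reasoning
    e : ℕ
    e = d ℕ.∸ suc j
    1+j<p : suc j < p
    1+j<p = ℕ.≤-<-trans (ℕ.m≤n+m (suc j) d) d+1+j<p
    d∸j≡ : d ℕ.∸ j ≡ suc e
    d∸j≡ = ℕ.+-∸-assoc 1 1+j≤d
    1+e<p : suc e < p
    1+e<p = ℕ.≤-<-trans (ℕ.≤-trans (ℕ.≤-reflexive (sym d∸j≡)) (ℕ.≤-trans (ℕ.m∸n≤m d j) (ℕ.m≤m+n d (suc j)))) d+1+j<p
    1+d+j<p : suc (d ℕ.+ j) < p
    1+d+j<p = subst (_< p) (ℕ.+-suc d j) d+1+j<p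
    N M D J E z g cⱼ r s t ρ : ℚ
    N = ℤ→ℚ n
    M = ℕ→ℚ m
    D = ℕ→ℚ d
    J = ℕ→ℚ j
    E = ℕ→ℚ e
    z = D + P * N
    g = c N m
    cⱼ = c D j
    r = 1/suc j
    s = 1/suc e
    t = 1/suc (d ℕ.+ j)
    ρ = 1/suc (p ℕ.* m ℕ.+ j)
    N-int : Integral N
    N-int = ℤ-integral n
    M-int : Integral M
    M-int = ℕ-integral m
    suc-integral : ∀ k → Integral (1ℚ + ℕ→ℚ k)
    suc-integral k = +-integral 1-integral (ℕ-integral k)
    s-int : Integral s
    s-int = 1/suc-integral-< 1+e<p
    t-int : Integral t
    t-int = 1/suc-integral-< 1+d+j<p
    ρ-int : Integral ρ
    ρ-int = ρ-integral m 1+j<p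
    Jρ : (1ℚ + J + P * M) * ρ ≡ 1ℚ
    Jρ = trans (cong (_* ρ) (trans (regroup J (P * M))
        (cong (1ℚ +_) (sym (ℕ→ℚ-p*+ m j)))))
      (1/suc-inverse (p ℕ.* m ℕ.+ j))
      where
      regroup : ∀ J x → 1ℚ + J + x ≡ 1ℚ + (x + J)
      regroup = solve-∀ ℚ-ring
    near : Square≈ ((1ℚ + J) * ρ) (- (M * r))
    near = square≈-quotient⁻¹ (1/suc-inverse j) Jρ (suc-integral j) (1/suc-integral-< 1+j<p) M-int ρ-int
    D≡ : D ≡ 1ℚ + E + J
    D≡ = trans (cong ℕ→ℚ (trans (sym (ℕ.m∸n+n≡m (ℕ.<⇒≤ 1+j≤d))) (cong (ℕ._+ j) d∸j≡)))
      (trans (ℕ→ℚ-homo-+ (suc e) j) (cong (_+ J) (ℕ→ℚ-suc e)))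
    u : ℚ
    u = (1ℚ + E + P * (N - M)) * s * ((1ℚ + ℕ→ℚ (d ℕ.+ j) + P * (N + M)) * t * ((1ℚ + J) * ρ * ((1ℚ + J) * ρ)))
    inverses : (1ℚ + E) * s * ((1ℚ + (D + J)) * t * ((1ℚ + J) * r * ((1ℚ + J) * r))) ≡ 1ℚ
    inverses = cong₂ _*_ (1/suc-inverse e) (cong₂ _*_
      (trans (cong (λ x → (1ℚ + x) * t) (sym (ℕ→ℚ-homo-+ d j))) (1/suc-inverse (d ℕ.+ j)))
      (cong₂ _*_ (1/suc-inverse j) (1/suc-inverse j)))
    G′≡ : c z (p ℕ.* m ℕ.+ suc j) ≡ g * c D (suc j) * (v * u)
    G′≡ = begin
      c z (p ℕ.* m ℕ.+ suc j)
        ≡⟨ trans (cong (c z) (ℕ.+-suc (p ℕ.* m) j)) (hyp-suc (- z) (z + 1ℚ) (p ℕ.* m ℕ.+ j)) ⟩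
      c z (p ℕ.* m ℕ.+ j) * ((- z + ℕ→ℚ (p ℕ.* m ℕ.+ j)) * (z + 1ℚ + ℕ→ℚ (p ℕ.* m ℕ.+ j))) * (ρ * ρ)
        ≡⟨ cong₂ (λ a b → a * ((- z + b) * (z + 1ℚ + b)) * (ρ * ρ)) G≡
             (ℕ→ℚ-p*+ m j) ⟩
      g * cⱼ * v * ((- (D + P * N) + (P * M + J)) * (D + P * N + 1ℚ + (P * M + J))) * (ρ * ρ)
        ≡⟨ substitute g cⱼ v D P N M J E r s t ρ D≡ inverses ⟩
      g * (cⱼ * ((- D + J) * (D + 1ℚ + J)) * (r * r)) *
        (v * ((1ℚ + E + P * (N - M)) * s * ((1ℚ + (D + J) + P * (N + M)) * t * ((1ℚ + J) * ρ * ((1ℚ + J) * ρ)))))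
        ≡⟨ cong₂ (λ a b → g * a * (v *
             ((1ℚ + E + P * (N - M)) * s * ((1ℚ + b + P * (N + M)) * t * ((1ℚ + J) * ρ * ((1ℚ + J) * ρ))))))
             (sym (hyp-suc (- D) (D + 1ℚ) j)) (sym (ℕ→ℚ-homo-+ d j)) ⟩
      g * c D (suc j) * (v * u) ∎
      where
      linear₁ : ∀ P N M J E → - (1ℚ + E + J + P * N) + (P * M + J) ≡ - (1ℚ + E + P * (N - M))
      linear₁ = solve-∀ ℚ-ring
      linear₂ : ∀ P N M J D → D + P * N + 1ℚ + (P * M + J) ≡ 1ℚ + (D + J) + P * (N + M)
      linear₂ = solve-∀ ℚ-ring
      linear₃ : ∀ E J → - (1ℚ + E + J) + J ≡ - (1ℚ + E)
      linear₃ = solve-∀ ℚ-ring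
      linear₄ : ∀ D J → D + 1ℚ + J ≡ 1ℚ + (D + J)
      linear₄ = solve-∀ ℚ-ring
      regroup : ∀ g c v X Y ρ e f j r s t →
        g * c * v * (- X * Y) * (ρ * ρ) - g * (c * (- e * f) * (r * r)) * (v * (X * s * (Y * t * (j * ρ * (j * ρ)))))
        ≡ g * c * v * X * Y * (ρ * ρ) * (e * s * (f * t * (j * r * (j * r))) - 1ℚ)
      regroup = solve-∀ ℚ-ring
      -- All quantities become variables so that D ≡ 1 + E + J can be matched with `refl`.
      substitute : ∀ g c v D P N M J E r s t ρ → D ≡ 1ℚ + E + J →
        (1ℚ + E) * s * ((1ℚ + (D + J)) * t * ((1ℚ + J) * r * ((1ℚ + J) * r))) ≡ 1ℚ →
        g * c * v * ((- (D + P * N) + (P * M + J)) * (D + P * N + 1ℚ + (P * M + J))) * (ρ * ρ) ≡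
        g * (c * ((- D + J) * (D + 1ℚ + J)) * (r * r)) *
          (v * ((1ℚ + E + P * (N - M)) * s * ((1ℚ + (D + J) + P * (N + M)) * t * ((1ℚ + J) * ρ * ((1ℚ + J) * ρ)))))
      substitute g c v D P N M J E r s t ρ refl h = trans
        (cong₂ (λ x y → g * c * v * (x * y) * (ρ * ρ)) (linear₁ P N M J E) (linear₂ P N M J D))
        (trans (combine₁ (g * c * v * (1ℚ + E + P * (N - M)) * (1ℚ + (D + J) + P * (N + M)) * (ρ * ρ)) h
          (regroup g c v (1ℚ + E + P * (N - M)) (1ℚ + (D + J) + P * (N + M)) ρ (1ℚ + E) (1ℚ + (D + J)) (1ℚ + J) r s t))
        (cong₂ (λ x y → g * (c * (x * y) * (r * r)) *
            (v * ((1ℚ + E + P * (N - M)) * s * ((1ℚ + (D + J) + P * (N + M)) * t * ((1ℚ + J) * ρ * ((1ℚ + J) * ρ))))))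
          (sym (linear₃ E J)) (sym (linear₄ D J))))
    h≡ : exponent N M d j + ((N - M) * s + ((N + M) * t + (- (M * r) + - (M * r)))) ≡ exponent N M d (suc j)
    h≡ = trans (cong (λ k → (N + M) * H (d ℕ.+ j) - (N - M) * H k - (M + M) * H j
        + ((N - M) * s + ((N + M) * t + (- (M * r) + - (M * r))))) d∸j≡)
      (trans (collect N M (H (d ℕ.+ j)) (H e) (H j) r s t)
        (cong (λ k → (N + M) * H k - (N - M) * H e - (M + M) * (H j + r)) (sym (ℕ.+-suc d j))))
      where
      collect : ∀ N M a b c r s t →
        (N + M) * a - (N - M) * (b + s) - (M + M) * c + ((N - M) * s + ((N + M) * t + (- (M * r) + - (M * r)))) ≡
        (N + M) * (a + t) - (N - M) * b - (M + M) * (c + r)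
      collect = solve-∀ ℚ-ring

  lift-dj : ∀ n m d j → j ≤ d → d ℕ.+ j < p →
    Lift (c (ℕ→ℚ d + P * ℤ→ℚ n) (p ℕ.* m ℕ.+ j)) (c (ℤ→ℚ n) m * c (ℕ→ℚ d) j) (exponent (ℤ→ℚ n) (ℕ→ℚ m) d j)
  lift-dj n m d zero _ d+0<p = lift-d0 n m d (lift-d n m d (subst (_< p) (ℕ.+-identityʳ d) d+0<p))
  lift-dj n m d (suc j) 1+j≤d d+1+j<p = lift-dj-suc n m d j 1+j≤d d+1+j<p
    (lift-dj n m d j (ℕ.<⇒≤ 1+j≤d) (ℕ.<⇒≤ (subst (_< p) (ℕ.+-suc d j) d+1+j<p)))

  -- Digits with a carry

  ℤ→ℚ-d+pn : ∀ d n → ℤ→ℚ (ℤ.+ d ℤ.+ ℤ.+ p ℤ.* n) ≡ ℕ→ℚ d + P * ℤ→ℚ n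
  ℤ→ℚ-d+pn d n = trans (ℤ→ℚ-homo-+ (ℤ.+ d) (ℤ.+ p ℤ.* n)) (cong (ℕ→ℚ d +_) (ℤ→ℚ-homo-* (ℤ.+ p) n))

  -- Subtracting j from d, or adding j to d, carries in base p.
  Carry : ℕ → ℕ → Set
  Carry d j = d < j ⊎ p ≤ d ℕ.+ j

  -- A carry first appears when j = d, where the factor -z+k is p(m-n), or when d+j+1 = p, where
  -- z+1+k is p(n+m+1). Afterwards divisibility persists, because the new denominators are prime to
  -- p.
  p∣c-step : ∀ n m d j → suc j < p → Carry d (suc j) →
             (Carry d j → DivBy P (c (ℕ→ℚ d + P * ℤ→ℚ n) (p ℕ.* m ℕ.+ j))) →
             DivBy P (c (ℕ→ℚ d + P * ℤ→ℚ n) (p ℕ.* m ℕ.+ suc j))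
  p∣c-step n m d j 1+j<p carry p∣cⱼ = divBy-resp (sym c-suc) (by-cases carry)
    where
    N M D z κ X Y G ρ : ℚ
    N = ℤ→ℚ n
    M = ℕ→ℚ m
    D = ℕ→ℚ d
    z = D + P * N
    κ = P * M + ℕ→ℚ j
    X = - z + κ
    Y = z + 1ℚ + κ
    G = c z (p ℕ.* m ℕ.+ j)
    ρ = 1/suc (p ℕ.* m ℕ.+ j)
    c-suc : c z (p ℕ.* m ℕ.+ suc j) ≡ G * (X * Y) * (ρ * ρ)
    c-suc = trans (cong (c z) (ℕ.+-suc (p ℕ.* m) j)) (trans (hyp-suc (- z) (z + 1ℚ) (p ℕ.* m ℕ.+ j))
      (cong (λ s → G * ((- z + s) * (z + 1ℚ + s)) * (ρ * ρ)) (ℕ→ℚ-p*+ m j)))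
    N-int : Integral N
    N-int = ℤ-integral n
    z-int : Integral z
    z-int = +-integral (ℕ-integral d) (*-integral P-integral N-int)
    κ-int : Integral κ
    κ-int = +-integral (*-integral P-integral (ℕ-integral m)) (ℕ-integral j)
    X-int : Integral X
    X-int = +-integral (neg-integral z-int) κ-int
    Y-int : Integral Y
    Y-int = +-integral (+-integral z-int 1-integral) κ-int
    G-int : Integral G
    G-int = subst (λ z → Integral (c z (p ℕ.* m ℕ.+ j))) (ℤ→ℚ-d+pn d n)
      (c-integral (ℤ.+ d ℤ.+ ℤ.+ p ℤ.* n) (p ℕ.* m ℕ.+ j))
    ρ²-int : Integral (ρ * ρ)
    ρ²-int = *-integral (ρ-integral m 1+j<p) (ρ-integral m 1+j<p)
    from-G : DivBy P G → DivBy P (G * (X * Y) * (ρ * ρ))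
    from-G h = divBy-*ʳ (divBy-*ʳ h (*-integral X-int Y-int)) ρ²-int
    from-X : d ≡ j → DivBy P (G * (X * Y) * (ρ * ρ))
    from-X d≡j = divBy-resp (regroup X G Y (ρ * ρ)) (divBy-*ʳ {x = X}
      (divBy (M - N) (-‿integral (ℕ-integral m) N-int)
        (trans (cong (λ i → - (D + P * N) + (P * M + ℕ→ℚ i)) (sym d≡j)) (factor P N M D)))
      (*-integral (*-integral G-int Y-int) ρ²-int))
      where
      regroup : ∀ X G Y r → X * (G * Y * r) ≡ G * (X * Y) * r
      regroup = solve-∀ ℚ-ring
      factor : ∀ P N M D → - (D + P * N) + (P * M + D) ≡ P * (M - N)
      factor = solve-∀ ℚ-ring
    from-Y : p ≡ suc (d ℕ.+ j) → DivBy P (G * (X * Y) * (ρ * ρ))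
    from-Y p≡ = divBy-resp (regroup Y G X (ρ * ρ)) (divBy-*ʳ {x = Y}
      (divBy (N + M + 1ℚ) (+-integral (+-integral N-int (ℕ-integral m)) 1-integral)
        (combine₁ (- 1ℚ) (trans (cong ℕ→ℚ {p} {suc (d ℕ.+ j)} p≡)
            (trans (ℕ→ℚ-suc (d ℕ.+ j)) (cong (1ℚ +_) (ℕ→ℚ-homo-+ d j))))
          (rearrange P N M D (ℕ→ℚ j))))
      (*-integral (*-integral G-int X-int) ρ²-int))
      where
      regroup : ∀ Y G X r → Y * (G * X * r) ≡ G * (X * Y) * r
      regroup = solve-∀ ℚ-ring
      rearrange : ∀ P N M D j → D + P * N + 1ℚ + (P * M + j) - P * (N + M + 1ℚ) ≡ - 1ℚ * (P - (1ℚ + (D + j)))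
      rearrange = solve-∀ ℚ-ring
    by-cases : Carry d (suc j) → DivBy P (G * (X * Y) * (ρ * ρ))
    by-cases (inj₁ d<1+j) = [ (λ d<j → from-G (p∣cⱼ (inj₁ d<j))) , from-X ]′ (ℕ.m≤n⇒m<n∨m≡n (ℕ.s≤s⁻¹ d<1+j))
    by-cases (inj₂ p≤d+1+j) = [ (λ p<1+d+j → from-G (p∣cⱼ (inj₂ (ℕ.s≤s⁻¹ p<1+d+j)))) , from-Y ]′
      (ℕ.m≤n⇒m<n∨m≡n (subst (p ≤_) (ℕ.+-suc d j) p≤d+1+j))

  p∣c : ∀ n m d j → d < p → j < p → Carry d j → DivBy P (c (ℕ→ℚ d + P * ℤ→ℚ n) (p ℕ.* m ℕ.+ j))
  p∣c n m d zero    d<p _ (inj₂ p≤d+0) = contradiction (subst (p ≤_) (ℕ.+-identityʳ d) p≤d+0) (ℕ.<⇒≱ d<p)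
  p∣c n m d (suc j) d<p 1+j<p carry = p∣c-step n m d j 1+j<p carry (p∣c n m d j d<p (ℕ.<⇒≤ 1+j<p))

  p∣c₀ : ∀ d j → d < p → j < p → Carry d j → DivBy P (c (ℕ→ℚ d) j)
  p∣c₀ d j d<p j<p carry = subst₂ (λ z k → DivBy P (c z k))
    (trans (cong (ℕ→ℚ d +_) (*-zeroʳ P)) (+-identityʳ (ℕ→ℚ d))) (cong (ℕ._+ j) (ℕ.*-zeroʳ p))
    (p∣c ℤ.0ℤ 0 d j d<p j<p carry)

  -- Below 2p the only positive multiple of p is p itself, and its reciprocal is cleared by P.
  PH-integral : ∀ {k} → k < p ℕ.+ p → Integral (P * H k)
  PH-integral {zero}  _ = *-integral P-integral (ℕ-integral 0)
  PH-integral {suc k} 1+k<2p = subst Integral (sym (*-distribˡ-+ P (H k) (1/suc k)))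
    (+-integral (PH-integral (ℕ.<⇒≤ 1+k<2p)) (P/suc-integral (p ∣? suc k)))
    where
    P/suc-integral : Dec (p ∣ suc k) → Integral (P * 1/suc k)
    P/suc-integral (no p∤) = *-integral P-integral (1/suc-integral p∤)
    P/suc-integral (yes (divides (suc zero) 1+k≡)) = subst Integral
      (sym (trans (cong (λ n → ℕ→ℚ n * 1/suc k) (sym (trans 1+k≡ (ℕ.+-identityʳ p)))) (recip-inverse (suc k)))) 1-integral
    P/suc-integral (yes (divides (suc (suc m)) 1+k≡)) = contradiction
      (ℕ.≤-trans (ℕ.+-monoʳ-≤ p (ℕ.m≤m+n p (m ℕ.* p))) (ℕ.≤-reflexive (sym 1+k≡))) (ℕ.<⇒≱ 1+k<2p)

  -- `K` is the summand of A′(d) without the leading 2; `L` is the summand of the residue identity.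
  K L : ℕ → ℕ → ℚ
  K d j = c (ℕ→ℚ d) j * c (ℕ→ℚ d) j * (H (d ℕ.+ j) - H (d ℕ.∸ j))
  L d j = c (ℕ→ℚ d) j * c (ℕ→ℚ d) j * harmonics d d j

  K-integral-no-carry : ∀ {d j} → d < p → d ℕ.+ j < p → Integral (K d j)
  K-integral-no-carry {d} {j} d<p d+j<p = *-integral (*-integral (c-integral (ℤ.+ d) j) (c-integral (ℤ.+ d) j))
    (-‿integral (H-integral d+j<p) (H-integral (ℕ.≤-<-trans (ℕ.m∸n≤m d j) d<p)))

  -- One of the two factors p in c(d,j)² clears the harmonic denominators, since d + j < 2p.
  K-integral-carry : ∀ {d j} → d < p → j < p → DivBy P (c (ℕ→ℚ d) j) → Integral (K d j)
  K-integral-carry {d} {j} d<p j<p (divBy y y-int c≡) = subst Integral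
    (trans (regroup P y (H (d ℕ.+ j)) (H (d ℕ.∸ j))) (cong (λ x → x * x * (H (d ℕ.+ j) - H (d ℕ.∸ j))) (sym c≡)))
    (*-integral (*-integral P-integral (*-integral y-int y-int))
      (-‿integral (PH-integral (ℕ.+-mono-< d<p j<p))
        (PH-integral (ℕ.≤-<-trans (ℕ.m∸n≤m d j) (ℕ.m≤n⇒m≤n+o p d<p)))))
    where
    regroup : ∀ P y a b → P * (y * y) * (P * a - P * b) ≡ P * y * (P * y) * (a - b)
    regroup = solve-∀ ℚ-ring

  K-integral : ∀ {d j} → d < p → j < p → Integral (K d j)
  K-integral {d} {j} d<p j<p = [ K-integral-no-carry d<p
    , (λ p≤d+j → K-integral-carry d<p j<p (p∣c₀ d j d<p j<p (inj₂ p≤d+j))) ]′ (ℕ.<-≤-connex (d ℕ.+ j) p)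

  term-no-carry : ∀ n m d j → Lift (c (ℕ→ℚ d + P * ℤ→ℚ n) (p ℕ.* m ℕ.+ j)) (c (ℤ→ℚ n) m * c (ℕ→ℚ d) j)
                (exponent (ℤ→ℚ n) (ℕ→ℚ m) d j) →
    c (ℕ→ℚ d + P * ℤ→ℚ n) (p ℕ.* m ℕ.+ j) * c (ℕ→ℚ d + P * ℤ→ℚ n) (p ℕ.* m ℕ.+ j) ≈
    c (ℤ→ℚ n) m * c (ℤ→ℚ n) m *
      (c (ℕ→ℚ d) j * c (ℕ→ℚ d) j + (P + P) * (ℤ→ℚ n * K d j + ℕ→ℚ m * L d j))
  term-no-carry n m d j (lift v G≡ (square≈ v-int h-int v²≈)) =
    ≈-trans (≡⇒≈ (trans (cong (λ x → x * x) G≡) (regroup g cⱼ v)))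
      (≈-trans (*-cong-≈ (*-integral v-int v-int) (*-integral (*-integral g-int c-int) (*-integral g-int c-int))
          (≡⇒≈ refl) v²≈)
        (≡⇒≈ (expand P (ℤ→ℚ n) (ℕ→ℚ m) g cⱼ (H (d ℕ.+ j)) (H (d ℕ.∸ j)) (H j))))
    where
    g cⱼ : ℚ
    g = c (ℤ→ℚ n) m
    cⱼ = c (ℕ→ℚ d) j
    g-int : Integral g
    g-int = c-integral n m
    c-int : Integral cⱼ
    c-int = c-integral (ℤ.+ d) j
    regroup : ∀ g c v → g * c * v * (g * c * v) ≡ g * c * (g * c) * (v * v)
    regroup = solve-∀ ℚ-ring
    expand : ∀ P N M g c a b h →
      g * c * (g * c) * (1ℚ + (P + P) * ((N + M) * a - (N - M) * b - (M + M) * h)) ≡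
      g * g * (c * c + (P + P) * (N * (c * c * (a - b)) + M * (c * c * (a + b - (h + h)))))
    expand = solve-∀ ℚ-ring

  -- Both sides are divisible by p²: the squares supply p², and the explicit P in front of the
  -- harmonic terms clears their denominators.
  term-carry : ∀ n m d j → d < p → j < p → Carry d j →
    c (ℕ→ℚ d + P * ℤ→ℚ n) (p ℕ.* m ℕ.+ j) * c (ℕ→ℚ d + P * ℤ→ℚ n) (p ℕ.* m ℕ.+ j) ≈
    c (ℤ→ℚ n) m * c (ℤ→ℚ n) m *
      (c (ℕ→ℚ d) j * c (ℕ→ℚ d) j + (P + P) * (ℤ→ℚ n * K d j + ℕ→ℚ m * L d j))
  term-carry n m d j d<p j<p carry = square (p∣c n m d j d<p j<p carry) (p∣c₀ d j d<p j<p carry)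
    where
    N M g G cⱼ a b h : ℚ
    N = ℤ→ℚ n
    M = ℕ→ℚ m
    g = c N m
    G = c (ℕ→ℚ d + P * N) (p ℕ.* m ℕ.+ j)
    cⱼ = c (ℕ→ℚ d) j
    a = H (d ℕ.+ j)
    b = H (d ℕ.∸ j)
    h = H j
    N-int : Integral N
    N-int = ℤ-integral n
    g-int : Integral g
    g-int = c-integral n m
    Pa-int : Integral (P * a)
    Pa-int = PH-integral (ℕ.+-mono-< d<p j<p)
    Pb-int : Integral (P * b)
    Pb-int = PH-integral (ℕ.≤-<-trans (ℕ.m∸n≤m d j) (ℕ.m≤n⇒m≤n+o p d<p))
    Ph-int : Integral (P * h)
    Ph-int = PH-integral (ℕ.m≤n⇒m≤n+o p j<p)
    square : DivBy P G → DivBy P cⱼ →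
      G * G ≈ g * g * (cⱼ * cⱼ + (P + P) * (N * (cⱼ * cⱼ * (a - b)) + M * (cⱼ * cⱼ * (a + b - (h + h)))))
    square (divBy x x-int G≡) (divBy y y-int c≡) = ≈-divBy (divBy
      (x * x - g * g * (y * y) * (1ℚ + (1ℚ + 1ℚ) * (N * (P * a - P * b) + M * (P * a + P * b - (P * h + P * h)))))
      (-‿integral (*-integral x-int x-int) (*-integral (*-integral (*-integral g-int g-int) (*-integral y-int y-int))
        (+-integral 1-integral (*-integral (ℕ-integral 2) (+-integral
          (*-integral N-int (-‿integral Pa-int Pb-int))
          (*-integral (ℕ-integral m) (-‿integral (+-integral Pa-int Pb-int) (+-integral Ph-int Ph-int))))))))
      (trans (cong₂ (λ s t → s * s - g * g *
            (t * t + (P + P) * (N * (t * t * (a - b)) + M * (t * t * (a + b - (h + h))))))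
          G≡ c≡) (factor P N M g x y a b h)))
      where
      factor : ∀ P N M g x y a b h →
        P * x * (P * x) - g * g * (P * y * (P * y) +
          (P + P) * (N * (P * y * (P * y) * (a - b)) + M * (P * y * (P * y) * (a + b - (h + h))))) ≡
        P * P * (x * x - g * g * (y * y) *
          (1ℚ + (1ℚ + 1ℚ) * (N * (P * a - P * b) + M * (P * a + P * b - (P * h + P * h)))))
      factor = solve-∀ ℚ-ring

  term-≈ : ∀ n m d j → d < p → j < p →
    c (ℕ→ℚ d + P * ℤ→ℚ n) (p ℕ.* m ℕ.+ j) * c (ℕ→ℚ d + P * ℤ→ℚ n) (p ℕ.* m ℕ.+ j) ≈
    c (ℤ→ℚ n) m * c (ℤ→ℚ n) m *
      (c (ℕ→ℚ d) j * c (ℕ→ℚ d) j + (P + P) * (ℤ→ℚ n * K d j + ℕ→ℚ m * L d j))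
  term-≈ n m d j d<p j<p =
    [ (λ j≤d → [ (λ d+j<p → term-no-carry n m d j (lift-dj n m d j j≤d d+j<p))
               , (λ p≤d+j → term-carry n m d j d<p j<p (inj₂ p≤d+j)) ]′ (ℕ.<-≤-connex (d ℕ.+ j) p))
    , (λ d<j → term-carry n m d j d<p j<p (inj₁ d<j)) ]′ (ℕ.≤-<-connex j d)

  -- Summation over the digits

  A′≡ : ∀ d → A′ d ≡ (1ℚ + 1ℚ) * sumTo d (K d)
  A′≡ d = cong ((1ℚ + 1ℚ) *_) (sum-cong d λ k _ → cong (_* (H (d ℕ.+ k) - H (d ℕ.∸ k))) (c²-ℕ d k))

  A′-integral : ∀ {d} → d < p → Integral (A′ d)
  A′-integral {d} d<p = subst Integral (sym (A′≡ d)) (*-integral (ℕ-integral 2)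
    (sum-integral d (λ j j≤d → K-integral d<p (ℕ.≤-<-trans j≤d d<p))))

  -- The right-hand side is free of M, because the m-part sums to zero exactly. It therefore comes
  -- out of the sum over m, which leaves A(n).
  digit-sum : ∀ d N M → d ≤ q →
    sumTo q (λ j → c (ℕ→ℚ d) j * c (ℕ→ℚ d) j + (P + P) * (N * K d j + M * L d j)) ≡
    A (ℤ.+ d) + P * N * A′ d
  digit-sum d N M d≤q = begin
    sumTo q (λ j → c² j + (P + P) * (N * K d j + M * L d j))
      ≡⟨ sum-+ q c² (λ j → (P + P) * (N * K d j + M * L d j)) ⟩
    sumTo q c² + sumTo q (λ j → (P + P) * (N * K d j + M * L d j))
      ≡⟨ cong₂ _+_ (A-as-sum (ℤ.+ d) d≤q) (trans (sum-*ˡ q (P + P) _) (cong ((P + P) *_)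
           (trans (sum-+ q (λ j → N * K d j) (λ j → M * L d j))
             (cong₂ _+_ (trans (sum-*ˡ q N (K d)) (cong (N *_) (truncate (λ j → H (d ℕ.+ j) - H (d ℕ.∸ j)))))
               (trans (sum-*ˡ q M (L d)) (cong (M *_) (trans (truncate (harmonics d d)) (sum-harmonics d)))))))) ⟩
    A (ℤ.+ d) + (P + P) * (N * sumTo d (K d) + M * 0ℚ)
      ≡⟨ regroup (A (ℤ.+ d)) P N M (sumTo d (K d)) ⟩
    A (ℤ.+ d) + P * N * ((1ℚ + 1ℚ) * sumTo d (K d))
      ≡⟨ cong (λ x → A (ℤ.+ d) + P * N * x) (sym (A′≡ d)) ⟩
    A (ℤ.+ d) + P * N * A′ d ∎
    where
    open ≡-Reasoning
    c² : ℕ → ℚ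
    c² j = c (ℕ→ℚ d) j * c (ℕ→ℚ d) j
    truncate : ∀ (f : ℕ → ℚ) → sumTo q (λ j → c² j * f j) ≡ sumTo d (λ j → c² j * f j)
    truncate f = sum-extend-≤ d≤q λ j d<j →
      trans (cong (λ x → x * x * f j) (c-vanish (ℤ.+ d) j d<j)) (*-zeroˡ (f j))
    regroup : ∀ a P N M k → a + (P + P) * (N * k + M * 0ℚ) ≡ a + P * N * ((1ℚ + 1ℚ) * k)
    regroup = solve-∀ ℚ-ring

  A-≈ : ∀ d n → d < p →
    A (ℤ.+ d ℤ.+ ℤ.+ p ℤ.* n) ≈ (A (ℤ.+ d) + ℤ→ℚ (ℤ.+ p ℤ.* n) * A′ d) * A n
  A-≈ d n d<p = ≈-trans (≡⇒≈ digits) (≈-trans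
    (sum-cong-≈ R λ m _ → sum-cong-≈ q λ j j≤q → term-≈ n m d j d<p (j<p j≤q))
    (≡⇒≈ collect))
    where
    open ≡-Reasoning
    R : ℕ
    R = ℤ.∣ n ∣
    d≤q : d ≤ q
    d≤q = ℕ.s≤s⁻¹ (subst (d <_) p≡1+q d<p)
    j<p : ∀ {j} → j ≤ q → j < p
    j<p j≤q = subst (_ <_) (sym p≡1+q) (s≤s j≤q)
    N z B : ℚ
    N = ℤ→ℚ n
    z = ℕ→ℚ d + P * N
    B = A (ℤ.+ d) + P * N * A′ d
    -- The truncation at |d+pn| is extended to the last digit of block |n|; the triangle inequality
    -- treats both signs of n.
    bound : ℤ.∣ ℤ.+ d ℤ.+ ℤ.+ p ℤ.* n ∣ ≤ p ℕ.* R ℕ.+ q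
    bound = ℕ.≤-trans (ℤ.∣i+j∣≤∣i∣+∣j∣ (ℤ.+ d) (ℤ.+ p ℤ.* n))
      (ℕ.≤-trans (ℕ.+-mono-≤ d≤q (ℕ.≤-reflexive (ℤ.abs-* (ℤ.+ p) n))) (ℕ.≤-reflexive (ℕ.+-comm q (p ℕ.* R))))
    digits : A (ℤ.+ d ℤ.+ ℤ.+ p ℤ.* n) ≡
             sumTo R (λ m → sumTo q (λ j → c z (p ℕ.* m ℕ.+ j) * c z (p ℕ.* m ℕ.+ j)))
    digits = begin
      A (ℤ.+ d ℤ.+ ℤ.+ p ℤ.* n)
        ≡⟨ A-as-sum (ℤ.+ d ℤ.+ ℤ.+ p ℤ.* n) bound ⟨
      sumTo (p ℕ.* R ℕ.+ q) (λ k → c (ℤ→ℚ (ℤ.+ d ℤ.+ ℤ.+ p ℤ.* n)) k * c (ℤ→ℚ (ℤ.+ d ℤ.+ ℤ.+ p ℤ.* n)) k)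
        ≡⟨ cong (λ z → sumTo (p ℕ.* R ℕ.+ q) (λ k → c z k * c z k)) (ℤ→ℚ-d+pn d n) ⟩
      sumTo (p ℕ.* R ℕ.+ q) (λ k → c z k * c z k)
        ≡⟨ subst (λ p → sumTo (p ℕ.* R ℕ.+ q) (λ k → c z k * c z k) ≡
               sumTo R (λ m → sumTo q (λ j → c z (p ℕ.* m ℕ.+ j) * c z (p ℕ.* m ℕ.+ j))))
             (sym p≡1+q) (sum-blocks q R (λ k → c z k * c z k)) ⟩
      sumTo R (λ m → sumTo q (λ j → c z (p ℕ.* m ℕ.+ j) * c z (p ℕ.* m ℕ.+ j))) ∎
    collect : sumTo R (λ m → sumTo q (λ j → c N m * c N m *
                (c (ℕ→ℚ d) j * c (ℕ→ℚ d) j + (P + P) * (N * K d j + ℕ→ℚ m * L d j)))) ≡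
              (A (ℤ.+ d) + ℤ→ℚ (ℤ.+ p ℤ.* n) * A′ d) * A n
    collect = begin
      _ ≡⟨ sum-cong R (λ m _ → trans (sum-*ˡ q (c N m * c N m) _)
             (trans (cong (c N m * c N m *_) (digit-sum d N (ℕ→ℚ m) d≤q)) (*-comm (c N m * c N m) B))) ⟩
      sumTo R (λ m → B * (c N m * c N m))
        ≡⟨ trans (sum-*ˡ R B (λ m → c N m * c N m)) (cong (B *_) (A-as-sum n ℕ.≤-refl)) ⟩
      B * A n
        ≡⟨ cong (λ x → (A (ℤ.+ d) + x * A′ d) * A n) (sym (ℤ→ℚ-homo-* (ℤ.+ p) n)) ⟩
      (A (ℤ.+ d) + ℤ→ℚ (ℤ.+ p ℤ.* n) * A′ d) * A n ∎

  ≈⇒CongModIn : ∀ {x y} → x ≈ y → CongModIn p (p ^ 2) x y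
  ≈⇒CongModIn (≈-divBy (divBy r r-int x-y≡)) =
    r , integral⇒p∤↧ r-int , trans x-y≡ (cong (_* r) (sym (ℕ→ℚ-square p)))

open import Data.Integer using (ℤ; +_) renaming (_+_ to _+ℤ_; _*_ to _*ℤ_)

theorem6 : (p : ℕ) → Prime p → (d : ℕ) → d < p →
  ¬ (p ∣ ↧ₙ (A′ d)) ×
  ((n : ℤ) → CongModIn p (p ^ 2)
    (A (+ d +ℤ (+ p *ℤ n)))
    ((A (+ d) + ℤ→ℚ (+ p *ℤ n) * A′ d) * A n))
theorem6 p p-prime d d<p = integral⇒p∤↧ (A′-integral d<p) , λ n → ≈⇒CongModIn (A-≈ d n d<p)
  where
  open PAdic p p-prime
  open Supercongruence p (ℕ.pred p) (sym (ℕ.suc-pred p {{prime⇒nonZero p-prime}})) p-prime
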